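{- Let $k$ be a positive integer. For any $2k$-connected line graph $L(G)$ and any $S \subsetneq V(L(G))$ with $|S| \leq k$, the graph $L(G)-S$ has $k$ completely independent spanning trees if $G$ is not super edge-connected or $\delta(G) \geq 2k$.
   Context: All graphs are finite, simple and undirected. $L(G)$ is the line graph of $G$ (vertex set $E(G)$, two vertices adjacent iff the corresponding edges share an endpoint). $\delta(G)$ is the minimum degree of $G$. A graph is $k$-connected if its (vertex) connectivity is at least $k$. An edge-cut of a connected graph is a set of edges whose removal disconnects it; a connected graph is super edge-connected if every minimum edge-cut isolates a vertex. Spanning trees $T_1,\dots,T_k$ of a graph $H$ are completely independent if for any two distinct vertices $u,v$ of $H$, the $u$–$v$ paths in $T_1,\dots,T_k$ are pairwise edge-disjoint and pairwise share no vertex other than $u$ and $v$. -}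

module Defs where

open import Data.Nat using (ℕ; _≤_; _<_; _<ᵇ_; _*_)
open import Data.Fin using (Fin; toℕ)
open import Data.Fin.Properties using () renaming (_≟_ to _≟ᶠ_)
open import Data.Bool using (Bool; true; false; T; not; _∧_)
open import Data.Bool.Properties using (T-irrelevant)
open import Data.List using (List; []; _∷_; length; filterᵇ; allFin)
open import Data.Bool.ListAction using (any)
open import Data.Empty using (⊥)
open import Data.List.Relation.Unary.Any using (Any)
import Data.List.Relation.Unary.Any as Any
open import Data.List.Relation.Unary.Unique.Propositional using (Unique)
open import Data.List.Membership.Propositional using (_∈_)
open import Data.Product using (Σ; _×_; _,_; proj₁; proj₂; ∃)
open import Data.Product.Properties using (≡-dec)
open import Data.Sum using (_⊎_; inj₁; inj₂)
import Data.Sum as Sum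
open import Relation.Nullary using (¬_; yes; no)
open import Relation.Nullary.Decidable using (isYes)
open import Relation.Binary.Definitions using (DecidableEquality)
open import Relation.Binary.PropositionalEquality
  using (_≡_; _≢_; refl; sym; trans; cong; subst)

record Graph : Set₁ where
  field
    V          : Set
    _≟_        : DecidableEquality V
    Adj        : V → V → Set
    Adj-sym    : ∀ {a b} → Adj a b → Adj b a
    Adj-irrefl : ∀ {a} → ¬ Adj a a

Σ-dec : {A : Set} {P : A → Set} → DecidableEquality A →
        (∀ {x} (p q : P x) → p ≡ q) → DecidableEquality (Σ A P)
Σ-dec _≟A_ irr (a , p) (b , q) with a ≟A b
... | no ¬eq = no (λ e → ¬eq (cong proj₁ e))
... | yes refl = yes (cong (a ,_) (irr p q))

data Walk {V : Set} (R : V → V → Set) : V → V → Set where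
  here : ∀ {u} → Walk R u u
  step : ∀ {u w v} → R u w → Walk R w v → Walk R u v

verts : ∀ {V : Set} {R : V → V → Set} {u v} → Walk R u v → List V
verts {u = u} here       = u ∷ []
verts {u = u} (step _ p) = u ∷ verts p

wedges : ∀ {V : Set} {R : V → V → Set} {u v} → Walk R u v → List (V × V)
wedges here                        = []
wedges {u = u} (step {w = w} _ p)  = (u , w) ∷ wedges p

wlen : ∀ {V : Set} {R : V → V → Set} {u v} → Walk R u v → ℕ
wlen p = length (wedges p)

IsPath : ∀ {V : Set} {R : V → V → Set} {u v} → Walk R u v → Set
IsPath p = Unique (verts p)

module _ (H : Graph) where
  open Graph H

  Connected : Set
  Connected = ∀ u v → Walk Adj u v

  memᵇ : V → List V → Bool
  memᵇ v S = any (λ x → isYes (v ≟ x)) S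

  delete : List V → Graph
  delete S = record
    { V          = Σ V (λ v → T (not (memᵇ v S)))
    ; _≟_        = Σ-dec _≟_ (λ p q → T-irrelevant p q)
    ; Adj        = λ a b → Adj (proj₁ a) (proj₁ b)
    ; Adj-sym    = Adj-sym
    ; Adj-irrefl = Adj-irrefl
    }

  KConnected : ℕ → Set
  KConnected k =
    (Σ (List V) λ xs → Unique xs × k < length xs) ×
    (∀ (S : List V) → length S < k → Connected' (delete S))
    where
    Connected' : Graph → Set
    Connected' G = ∀ u v → Walk (Graph.Adj G) u v

  IsSpanningTree : (V → V → Bool) → Set
  IsSpanningTree t =
    (∀ a b → t a b ≡ true → Adj a b) ×
    (∀ a b → t a b ≡ t b a) ×
    (∀ u v → Walk R u v) ×
    -- acyclic: no edge a b closes a path from b back to a of length ≥ 2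
    (∀ a b → R a b → (p : Walk R b a) → IsPath p → ¬ (2 ≤ wlen p))
    where
    R : V → V → Set
    R a b = t a b ≡ true

  CompletelyIndependent : (V → V → Bool) → (V → V → Bool) → Set
  CompletelyIndependent t₁ t₂ =
    ∀ u v → u ≢ v →
    (P : Walk (λ a b → t₁ a b ≡ true) u v) → IsPath P →
    (Q : Walk (λ a b → t₂ a b ≡ true) u v) → IsPath Q →
    (∀ a b → (a , b) ∈ wedges P → ¬ ((a , b) ∈ wedges Q ⊎ (b , a) ∈ wedges Q)) ×
    (∀ x → x ∈ verts P → x ∈ verts Q → x ≡ u ⊎ x ≡ v)

  HasCISTs : ℕ → Set
  HasCISTs k =
    Σ (Fin k → V → V → Bool) λ ts →
      (∀ i → IsSpanningTree (ts i)) ×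
      (∀ i j → i ≢ j → CompletelyIndependent (ts i) (ts j))

record SimpleGraph (n : ℕ) : Set where
  field
    adj        : Fin n → Fin n → Bool
    adj-sym    : ∀ u v → adj u v ≡ adj v u
    adj-irrefl : ∀ u → adj u u ≡ false

module _ {n : ℕ} (G : SimpleGraph n) where
  open SimpleGraph G

  private
    irr-lemma : ∀ {u} → adj u u ≡ true → ⊥
    irr-lemma {u} e with trans (sym e) (adj-irrefl u)
    ... | ()

  toGraph : Graph
  toGraph = record
    { V          = Fin n
    ; _≟_        = _≟ᶠ_
    ; Adj        = λ u v → adj u v ≡ true
    ; Adj-sym    = λ {a} {b} e → trans (adj-sym b a) e
    ; Adj-irrefl = irr-lemma
    }

  Edge : Set
  Edge = Σ (Fin n × Fin n) λ uv →
           T ((toℕ (proj₁ uv) <ᵇ toℕ (proj₂ uv)) ∧ adj (proj₁ uv) (proj₂ uv))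

  _≟ᴱ_ : DecidableEquality Edge
  _≟ᴱ_ = Σ-dec (≡-dec _≟ᶠ_ _≟ᶠ_) (λ p q → T-irrelevant p q)

  Share : Edge → Edge → Set
  Share ((a , b) , _) ((c , d) , _) = a ≡ c ⊎ a ≡ d ⊎ b ≡ c ⊎ b ≡ d

  private
    share-sym : ∀ {e f} → Share e f → Share f e
    share-sym (inj₁ x) = inj₁ (sym x)
    share-sym (inj₂ (inj₁ x)) = inj₂ (inj₂ (inj₁ (sym x)))
    share-sym (inj₂ (inj₂ (inj₁ x))) = inj₂ (inj₁ (sym x))
    share-sym (inj₂ (inj₂ (inj₂ x))) = inj₂ (inj₂ (inj₂ (sym x)))

  LineGraph : Graph
  LineGraph = record
    { V          = Edge
    ; _≟_        = _≟ᴱ_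
    ; Adj        = λ e f → e ≢ f × Share e f
    ; Adj-sym    = λ {e} {f} (ne , s) → (λ x → ne (sym x)) , share-sym {e} {f} s
    ; Adj-irrefl = λ (ne , _) → ne refl
    }

  Hits : Fin n → Fin n → Edge → Set
  Hits u v e = proj₁ e ≡ (u , v) ⊎ proj₁ e ≡ (v , u)

  deleteEdges : List Edge → Graph
  deleteEdges F = record
    { V          = Fin n
    ; _≟_        = _≟ᶠ_
    ; Adj        = λ u v → adj u v ≡ true × ¬ Any (Hits u v) F
    ; Adj-sym    = λ {a} {b} (e , h) →
                     trans (adj-sym b a) e , (λ x → h (Any.map Sum.swap x))
    ; Adj-irrefl = λ (e , _) → irr-lemma e
    }

  IsEdgeCut : List Edge → Set
  IsEdgeCut F = Unique F × ¬ Connected (deleteEdges F)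

  IsMinEdgeCut : List Edge → Set
  IsMinEdgeCut F = IsEdgeCut F × (∀ F' → IsEdgeCut F' → length F ≤ length F')

  SuperEdgeConnected : Set
  SuperEdgeConnected =
    Connected toGraph ×
    (∀ F → IsMinEdgeCut F →
       ∃ λ v → ∀ u → ¬ Graph.Adj (deleteEdges F) u v)

  degree : Fin n → ℕ
  degree v = length (filterᵇ (adj v) (allFin n))

  MinDegreeAtLeast : ℕ → Set
  MinDegreeAtLeast d = ∀ v → d ≤ degree v

{-# OPTIONS --safe #-}
-- Both alternatives of the hypothesis make G 2k-edge-connected: a cut of fewer than 2k edges cannot separate two
-- edges in L(G), hence isolates a vertex.  So every partition of V(G) into p ≥ 2 classes is crossed by at least kp edges,
-- and by at least k(p − 1) edges outside S.
--
-- Tree packing, after T. Kaiser's short proof: colour the edges of G − S with k colours and refine the trivial partition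
-- by repeatedly splitting its classes into the components of one colour inside them.  In the stable partition, if some
-- colour is not connected, there are more crossing edges than forests in all colours could hold; the cycle-closing edge of
-- lowest level can be recoloured so that the sequence of partitions becomes lexicographically coarser.  Hence some
-- colouring has all its colour classes connected and spanning.
--
-- Independent trees: root the colours at distinct vertices, which are the far ends of edges of different colours at one
-- vertex.  Each edge has a head, its end nearer to the root of its colour, and its parent in tree c is an edge of colour c at
-- its head which leads on towards root c.  Only edges of colour c are inner nodes of tree c, and two edges of
-- colours c and d that are parents of each other would have a common head equal to both roots.
module Submission where

open import Defs
open import Data.Bool using (Bool; true; false; T; not; _∧_)
open import Data.Bool.Properties using (T-irrelevant; ∨-comm; T-∧; T-≡) renaming (_≟_ to _≟ᵇ_)
open import Data.Empty using (⊥)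
open import Data.Fin using (Fin; toℕ)
import Data.Fin as Fin
open import Data.Fin.Properties using (all?; any?; ¬∀⟶∃¬; toℕ-injective) renaming (_≟_ to _≟ᶠ_)
open import Data.List using (List; []; _∷_; _++_; length; map; filter; filterᵇ; allFin; cartesianProduct)
open import Data.List.Membership.Propositional using (_∈_; _∉_; find; lose)
open import Data.List.Membership.Propositional.Properties using (∈-allFin; ∈-cartesianProduct⁺; ∈-filter⁺; ∈-filter⁻; ∈-map⁺)
import Data.List.Membership.DecPropositional as DecMembership
open import Data.List.Properties using (length-tabulate; length-map; ++-identityʳ; filter-accept; filter-reject)
open import Data.List.Relation.Unary.All using (All; []; _∷_)
import Data.List.Relation.Unary.All as All
open import Data.List.Relation.Unary.AllPairs using ([]; _∷_)
open import Data.List.Relation.Unary.Any using (Any; here; there)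
import Data.List.Relation.Unary.Any as Any
open import Data.List.Relation.Unary.Any.Properties using (any⁺; any⁻)
open import Data.List.Relation.Unary.Unique.Propositional using (Unique)
open import Data.List.Relation.Unary.Unique.Propositional.Properties using (allFin⁺; cartesianProduct⁺; filter⁺)
open import Data.Nat using (ℕ; zero; suc; _+_; _*_; _≤_; _<_; z≤n; s≤s; _<ᵇ_; _<?_; _≤?_)
open import Data.Nat.Properties hiding (_≟_; _<?_; _≤?_)
open import Data.Nat.Induction using (<-wellFounded)
open import Data.Product using (Σ; ∃; ∃₂; _×_; _,_; proj₁; proj₂)
open import Data.Product.Properties using (≡-dec)
open import Data.Sum using (_⊎_; inj₁; inj₂; [_,_]′; swap)
open import Function using (id; _∘_)
open import Function.Bundles using (Equivalence)
open import Induction.WellFounded using (Acc; acc)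
open import Relation.Binary.Definitions using (DecidableEquality; tri<; tri≈; tri>)
open import Relation.Binary.PropositionalEquality using (_≡_; _≢_; refl; sym; trans; cong; cong₂; subst)
open import Relation.Binary.Structures using (IsEquivalence)
open import Relation.Nullary using (¬_; Dec; yes; no; does; contradiction)
open import Relation.Nullary.Decidable using (_×-dec_; _⊎-dec_; ¬?; decidable-stable; isYes; toWitness; fromWitness; dec-true; dec-false; T?)
open import Relation.Unary using (Decidable)

-- Counting

∑ : {A : Set} → List A → (A → ℕ) → ℕ
∑ []       f = 0
∑ (x ∷ xs) f = f x + ∑ xs f

⟦_⟧ : {A : Set} → Dec A → ℕ
⟦ yes _ ⟧ = 1
⟦ no _ ⟧  = 0

module _ {A B : Set} where

  ⟦⟧-mono : (a? : Dec A) (b? : Dec B) → (A → B) → ⟦ a? ⟧ ≤ ⟦ b? ⟧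
  ⟦⟧-mono (no _)  b?      f = z≤n
  ⟦⟧-mono (yes a) (yes _) f = ≤-refl
  ⟦⟧-mono (yes a) (no ¬b) f = contradiction (f a) ¬b

  ⟦⟧-strict : (a? : Dec A) (b? : Dec B) → ¬ A → B → ⟦ a? ⟧ < ⟦ b? ⟧
  ⟦⟧-strict (yes a) b?      ¬a b = contradiction a ¬a
  ⟦⟧-strict (no _)  (yes _) ¬a b = ≤-refl
  ⟦⟧-strict (no _)  (no ¬b) ¬a b = contradiction b ¬b

⟦⟧≤1 : {A : Set} (a? : Dec A) → ⟦ a? ⟧ ≤ 1
⟦⟧≤1 (yes _) = ≤-refl
⟦⟧≤1 (no _)  = z≤n

⟦⟧-true : {A : Set} (a? : Dec A) → A → ⟦ a? ⟧ ≡ 1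
⟦⟧-true (yes _) a = refl
⟦⟧-true (no ¬a) a = contradiction a ¬a

⟦⟧-false : {A : Set} (a? : Dec A) → ¬ A → ⟦ a? ⟧ ≡ 0
⟦⟧-false (yes a) ¬a = contradiction a ¬a
⟦⟧-false (no _)  ¬a = refl

module _ {A B C : Set} where

  ⟦⟧-cover : (a? : Dec A) (b? : Dec B) (c? : Dec C) → (A → B ⊎ C) → ⟦ a? ⟧ ≤ ⟦ b? ⟧ + ⟦ c? ⟧
  ⟦⟧-cover (no _)  b? c? f = z≤n
  ⟦⟧-cover (yes a) b? c? f with f a
  ... | inj₁ b = ≤-trans (≤-reflexive (sym (⟦⟧-true b? b))) (m≤m+n _ _)
  ... | inj₂ c = ≤-trans (≤-reflexive (sym (⟦⟧-true c? c))) (m≤n+m _ _)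

  ⟦⟧-disjoint : (a? : Dec A) (b? : Dec B) (c? : Dec C) → (A → C) → (B → C) → (A → ¬ B) → ⟦ a? ⟧ + ⟦ b? ⟧ ≤ ⟦ c? ⟧
  ⟦⟧-disjoint (no _)  b? c? f g h = ⟦⟧-mono b? c? g
  ⟦⟧-disjoint (yes a) b? c? f g h = ≤-reflexive (trans (cong suc (⟦⟧-false b? (h a))) (sym (⟦⟧-true c? (f a))))

module _ {A : Set} where

  ∑-mono : (xs : List A) {f g : A → ℕ} → (∀ x → f x ≤ g x) → ∑ xs f ≤ ∑ xs g
  ∑-mono []       h = z≤n
  ∑-mono (x ∷ xs) h = +-mono-≤ (h x) (∑-mono xs h)

  ∑-strict : {xs : List A} {f g : A → ℕ} {x : A} → (∀ x → f x ≤ g x) → x ∈ xs → f x < g x → ∑ xs f < ∑ xs g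
  ∑-strict {xs = _ ∷ xs} h (here refl) lt = +-mono-<-≤ lt (∑-mono xs h)
  ∑-strict               h (there x∈)  lt = +-mono-≤-< (h _) (∑-strict h x∈ lt)

  ∑-+ : (xs : List A) (f g : A → ℕ) → ∑ xs (λ x → f x + g x) ≡ ∑ xs f + ∑ xs g
  ∑-+ []       f g = refl
  ∑-+ (x ∷ xs) f g = trans (cong (f x + g x +_) (∑-+ xs f g)) (interchange (f x) (g x) (∑ xs f) (∑ xs g))
    where
    interchange : ∀ a b c d → a + b + (c + d) ≡ a + c + (b + d)
    interchange a b c d = trans (+-assoc a b (c + d)) (trans (cong (a +_)
      (trans (sym (+-assoc b c d)) (trans (cong (_+ d) (+-comm b c)) (+-assoc c b d))))
      (sym (+-assoc a c (b + d))))

  ∑-const : (xs : List A) (m : ℕ) → ∑ xs (λ _ → m) ≡ length xs * m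
  ∑-const []       m = refl
  ∑-const (x ∷ xs) m = cong (m +_) (∑-const xs m)

  ∑-*ˡ : (xs : List A) (m : ℕ) (f : A → ℕ) → ∑ xs (λ x → m * f x) ≡ m * ∑ xs f
  ∑-*ˡ []       m f = sym (*-zeroʳ m)
  ∑-*ˡ (x ∷ xs) m f = trans (cong (m * f x +_) (∑-*ˡ xs m f)) (sym (*-distribˡ-+ m (f x) (∑ xs f)))

  ∑-bound : (xs : List A) {f : A → ℕ} {m : ℕ} → (∀ x → f x ≤ m) → ∑ xs f ≤ length xs * m
  ∑-bound xs h = ≤-trans (∑-mono xs h) (≤-reflexive (∑-const xs _))

  ∑-member : {xs : List A} (f : A → ℕ) {x : A} → x ∈ xs → f x ≤ ∑ xs f
  ∑-member f (here refl) = m≤m+n _ _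
  ∑-member f (there x∈)  = ≤-trans (∑-member f x∈) (m≤n+m _ _)

  length-filter≡∑ : {P : A → Set} (P? : Decidable P) (xs : List A) → length (filter P? xs) ≡ ∑ xs (λ x → ⟦ P? x ⟧)
  length-filter≡∑ P? []       = refl
  length-filter≡∑ P? (x ∷ xs) with P? x
  ... | yes _ = cong suc (length-filter≡∑ P? xs)
  ... | no _  = length-filter≡∑ P? xs

∑-swap : {A B : Set} (xs : List A) (ys : List B) (f : A → B → ℕ) →
         ∑ xs (λ x → ∑ ys (f x)) ≡ ∑ ys (λ y → ∑ xs (λ x → f x y))
∑-swap []       ys f = sym (trans (∑-const ys 0) (*-zeroʳ (length ys)))
∑-swap (x ∷ xs) ys f = trans (cong (∑ ys (f x) +_) (∑-swap xs ys f)) (sym (∑-+ ys (f x) _))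

module _ {A : Set} (_≟_ : DecidableEquality A) where

  ∑-indicator≤1 : {xs : List A} → Unique xs → ∀ a → ∑ xs (λ x → ⟦ a ≟ x ⟧) ≤ 1
  ∑-indicator≤1 []        a = z≤n
  ∑-indicator≤1 {x ∷ xs} (x∉ ∷ u) a with a ≟ x
  ... | no _     = ∑-indicator≤1 u a
  ... | yes refl = s≤s (≤-reflexive (vanish x∉))
    where
    vanish : {ys : List A} → All (a ≢_) ys → ∑ ys (λ y → ⟦ a ≟ y ⟧) ≡ 0
    vanish []        = refl
    vanish (≢y ∷ ps) = cong₂ _+_ (⟦⟧-false (a ≟ _) ≢y) (vanish ps)

  ∑-indicator≥1 : {xs : List A} {a : A} → a ∈ xs → 1 ≤ ∑ xs (λ x → ⟦ a ≟ x ⟧)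
  ∑-indicator≥1 {a = a} a∈ = ≤-trans (≤-reflexive (sym (⟦⟧-true (a ≟ a) refl))) (∑-member (λ x → ⟦ a ≟ x ⟧) a∈)

  -- Double counting of equal pairs: each entry of `xs` meets one in `ys`, and no entry of `ys`
  -- meets two in `xs`.
  Unique-⊆-length : {xs ys : List A} → Unique xs → (∀ {x} → x ∈ xs → x ∈ ys) → length xs ≤ length ys
  Unique-⊆-length {xs} {ys} u sub = begin
    length xs                                 ≡⟨ *-identityʳ (length xs) ⟨
    length xs * 1                             ≤⟨ covered xs sub ⟩
    ∑ xs (λ x → ∑ ys (λ y → ⟦ y ≟ x ⟧))       ≡⟨ ∑-swap xs ys (λ x y → ⟦ y ≟ x ⟧) ⟩
    ∑ ys (λ y → ∑ xs (λ x → ⟦ y ≟ x ⟧))       ≤⟨ ∑-bound ys (∑-indicator≤1 u) ⟩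
    length ys * 1                             ≡⟨ *-identityʳ (length ys) ⟩
    length ys                                 ∎
    where
    open ≤-Reasoning
    covered : ∀ zs → (∀ {x} → x ∈ zs → x ∈ ys) → length zs * 1 ≤ ∑ zs (λ x → ∑ ys (λ y → ⟦ y ≟ x ⟧))
    covered []       sub = z≤n
    covered (z ∷ zs) sub = +-mono-≤
      (≤-trans (≤-reflexive (sym (⟦⟧-true (z ≟ z) refl))) (∑-member (λ y → ⟦ y ≟ z ⟧) (sub (here refl))))
      (covered zs (sub ∘ there))

-- Passes from single colours to all of them: either some colour yields an edge to recolour, or
-- every colour has its forest.
sequence-⊎ : ∀ {k} {A : Set} {B : Fin k → Set} → (∀ c → A ⊎ B c) → A ⊎ (∀ c → B c)
sequence-⊎ {zero}  h = inj₂ λ ()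
sequence-⊎ {suc k} h with h Fin.zero | sequence-⊎ (h ∘ Fin.suc)
... | inj₁ a | _       = inj₁ a
... | inj₂ _ | inj₁ a  = inj₁ a
... | inj₂ b | inj₂ bs = inj₂ λ { Fin.zero → b ; (Fin.suc c) → bs c }

-- Partitions of the vertex set, represented by idempotent maps onto class representatives

infix 4 _≼_

-- Refinement of the partitions into fibres; the left side is the finer one. The codomains are free,
-- so that Boolean labellings can be compared too.
_≼_ : ∀ {n} {A B : Set} → (Fin n → A) → (Fin n → B) → Set
f ≼ g = ∀ {x y} → f x ≡ f y → g x ≡ g y

Idem : ∀ {n} → (Fin n → Fin n) → Set
Idem f = ∀ x → f (f x) ≡ f x

≼-absorb : ∀ {n} {A : Set} {f : Fin n → Fin n} {g : Fin n → A} → Idem f → f ≼ g → ∀ x → g (f x) ≡ g x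
≼-absorb idem f≼g x = f≼g (idem x)

module _ {n : ℕ} where

  -- The fixed points of an idempotent map are its class representatives. Those of an arbitrary map
  -- still lie in distinct fibres, so they never outnumber the classes.
  classes : (Fin n → Fin n) → ℕ
  classes f = ∑ (allFin n) (λ x → ⟦ f x ≟ᶠ x ⟧)

  1≤classes : {f : Fin n → Fin n} → Idem f → Fin n → 1 ≤ classes f
  1≤classes {f} idem x = ≤-trans (≤-reflexive (sym (⟦⟧-true (f (f x) ≟ᶠ f x) (idem x)))) (∑-member (λ z → ⟦ f z ≟ᶠ z ⟧) (∈-allFin (f x)))

  2≤classes : {f : Fin n → Fin n} → Idem f → ∀ {x y} → f x ≢ f y → 2 ≤ classes f
  2≤classes {f} idem {x} {y} fx≢fy = begin
    2                                                                      ≤⟨ +-mono-≤ (∑-indicator≥1 _≟ᶠ_ (∈-allFin (f x))) (∑-indicator≥1 _≟ᶠ_ (∈-allFin (f y))) ⟩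
    ∑ (allFin n) (λ z → ⟦ f x ≟ᶠ z ⟧) + ∑ (allFin n) (λ z → ⟦ f y ≟ᶠ z ⟧)  ≡⟨ ∑-+ (allFin n) _ _ ⟨
    ∑ (allFin n) (λ z → ⟦ f x ≟ᶠ z ⟧ + ⟦ f y ≟ᶠ z ⟧)                       ≤⟨ ∑-mono (allFin n) (λ z → ⟦⟧-disjoint (f x ≟ᶠ z) (f y ≟ᶠ z) (f z ≟ᶠ z) (λ { refl → idem x }) (λ { refl → idem y }) (λ { refl eq → fx≢fy (sym eq) })) ⟩
    classes f                                                              ∎
    where open ≤-Reasoning

  merge : (Fin n → Fin n) → Fin n → Fin n → Fin n → Fin n
  merge f a b x with f x ≟ᶠ f a
  ... | yes _ = f b
  ... | no _  = f x

  module _ (f : Fin n → Fin n) (a b : Fin n) where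

    merge-yes : ∀ {x} → f x ≡ f a → merge f a b x ≡ f b
    merge-yes {x} eq with f x ≟ᶠ f a
    ... | yes _ = refl
    ... | no ne = contradiction eq ne

    merge-no : ∀ {x} → f x ≢ f a → merge f a b x ≡ f x
    merge-no {x} ne with f x ≟ᶠ f a
    ... | yes eq = contradiction eq ne
    ... | no _   = refl

    merge-≼ : f ≼ merge f a b
    merge-≼ {x} {y} eq with f x ≟ᶠ f a
    ... | yes p = sym (merge-yes (trans (sym eq) p))
    ... | no p  = trans eq (sym (merge-no (p ∘ trans eq)))

    merge-joins : merge f a b a ≡ merge f a b b
    merge-joins with f b ≟ᶠ f a
    ... | yes p = merge-yes refl
    ... | no p  = merge-yes refl

    module _ (idem : Idem f) where

      merge-idem : Idem (merge f a b)
      merge-idem x with f x ≟ᶠ f a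
      ... | no p = trans (merge-no (p ∘ trans (sym (idem x)))) (idem x)
      ... | yes p with f (f b) ≟ᶠ f a
      ...   | yes _ = refl
      ...   | no _  = idem b

      -- `R` is any equivalence because the result serves both for equality of labels and for
      -- reachability by walks.
      merge-least : {R : Fin n → Fin n → Set} → IsEquivalence R → (∀ x → R (f x) x) → R a b → ∀ x → R (merge f a b x) x
      merge-least R-eq inv Rab x with f x ≟ᶠ f a
      ... | no _  = inv x
      ... | yes p = R.trans (inv b) (R.trans (R.sym Rab) (R.trans (R.sym (inv a)) (R.trans (R.reflexive (sym p)) (inv x))))
        where module R = IsEquivalence R-eq

      -- The representative `f a` stops being a fixed point, and no new fixed point arises.
      merge-classes : f a ≢ f b → suc (classes (merge f a b)) ≤ classes f
      merge-classes ne = begin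
        1 + classes (merge f a b)                                              ≤⟨ +-monoˡ-≤ _ (∑-indicator≥1 _≟ᶠ_ (∈-allFin (f a))) ⟩
        ∑ (allFin n) (λ z → ⟦ f a ≟ᶠ z ⟧) + classes (merge f a b)              ≡⟨ ∑-+ (allFin n) _ _ ⟨
        ∑ (allFin n) (λ z → ⟦ f a ≟ᶠ z ⟧ + ⟦ merge f a b z ≟ᶠ z ⟧)             ≤⟨ ∑-mono (allFin n) (λ z → ⟦⟧-disjoint (f a ≟ᶠ z) (merge f a b z ≟ᶠ z) (f z ≟ᶠ z) (λ { refl → idem a }) (proj₂ ∘ fixed z) (λ { refl eq → proj₁ (fixed z eq) (idem a) })) ⟩
        classes f                                                              ∎
        where
        open ≤-Reasoning
        fixed : ∀ z → merge f a b z ≡ z → f z ≢ f a × f z ≡ z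
        fixed z eq with f z ≟ᶠ f a
        ... | no p  = p , eq
        ... | yes p = contradiction (trans (sym p) (trans (cong f (sym eq)) (idem b))) ne

  -- A numerical fineness that drops strictly under proper coarsening; it supplies the digits of the
  -- measure on colourings.
  separated : (Fin n → Fin n) → ℕ
  separated f = ∑ (allFin n) λ x → ∑ (allFin n) λ y → ⟦ ¬? (f x ≟ᶠ f y) ⟧

  separated-mono : {f g : Fin n → Fin n} → f ≼ g → separated g ≤ separated f
  separated-mono f≼g = ∑-mono (allFin n) λ x → ∑-mono (allFin n) λ y → ⟦⟧-mono (¬? (_ ≟ᶠ _)) (¬? (_ ≟ᶠ _)) (_∘ f≼g)

  separated-strict : {f g : Fin n → Fin n} → f ≼ g → ∀ {x y} → g x ≡ g y → f x ≢ f y → separated g < separated f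
  separated-strict f≼g {x} {y} gx≡gy fx≢fy =
    ∑-strict (λ x → ∑-mono (allFin n) (pointwise x)) (∈-allFin x)
      (∑-strict (pointwise x) (∈-allFin y) (⟦⟧-strict (¬? (_ ≟ᶠ _)) (¬? (_ ≟ᶠ _)) (λ ne → ne gx≡gy) fx≢fy))
    where
    pointwise = λ x y → ⟦⟧-mono (¬? (_ ≟ᶠ _)) (¬? (_ ≟ᶠ _)) (_∘ f≼g {x} {y})

  separated≤ : (f : Fin n → Fin n) → separated f ≤ n * n
  separated≤ f = subst (λ m → separated f ≤ m * n) length-allFin (∑-bound (allFin n) λ x →
    subst (∑ (allFin n) (λ y → ⟦ ¬? (f x ≟ᶠ f y) ⟧) ≤_) (trans (*-identityʳ _) length-allFin)
      (∑-bound (allFin n) λ y → ⟦⟧≤1 (¬? (f x ≟ᶠ f y))))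
    where
    length-allFin : length (allFin n) ≡ n
    length-allFin = length-tabulate id

-- Connected components of a decidable set of edges

module Components {n : ℕ} {E : Set} (s t : E → Fin n) (es : List E) (all∈ : ∀ e → e ∈ es) where

  module _ {A : E → Set} (A? : Decidable A) where

    mergeAll : List E → Fin n → Fin n
    mergeAll []       = id
    mergeAll (e ∷ xs) with A? e
    ... | yes _ = merge (mergeAll xs) (s e) (t e)
    ... | no _  = mergeAll xs

    mergeAll-idem : ∀ xs → Idem (mergeAll xs)
    mergeAll-idem []       x = refl
    mergeAll-idem (e ∷ xs) x with A? e
    ... | yes _ = merge-idem (mergeAll xs) (s e) (t e) (mergeAll-idem xs) x
    ... | no _  = mergeAll-idem xs x

    mergeAll-joins : ∀ {xs e} → e ∈ xs → A e → mergeAll xs (s e) ≡ mergeAll xs (t e)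
    mergeAll-joins {e′ ∷ xs} (here refl) a with A? e′
    ... | yes _ = merge-joins (mergeAll xs) (s e′) (t e′)
    ... | no ¬a = contradiction a ¬a
    mergeAll-joins {e′ ∷ xs} (there e∈) a with A? e′
    ... | yes _ = merge-≼ (mergeAll xs) (s e′) (t e′) (mergeAll-joins e∈ a)
    ... | no _  = mergeAll-joins e∈ a

    mergeAll-least : {R : Fin n → Fin n → Set} → IsEquivalence R → (∀ e → A e → R (s e) (t e)) → ∀ xs x → R (mergeAll xs x) x
    mergeAll-least R-eq h []       x = IsEquivalence.refl R-eq
    mergeAll-least R-eq h (e ∷ xs) x with A? e
    ... | yes a = merge-least (mergeAll xs) (s e) (t e) (mergeAll-idem xs) R-eq (mergeAll-least R-eq h xs) (h e a) x
    ... | no _  = mergeAll-least R-eq h xs x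

    component : Fin n → Fin n
    component = mergeAll es

    component-idem : Idem component
    component-idem = mergeAll-idem es

    component-joins : ∀ e → A e → component (s e) ≡ component (t e)
    component-joins e = mergeAll-joins (all∈ e)

    component-least : {R : Fin n → Fin n → Set} → IsEquivalence R → (∀ e → A e → R (s e) (t e)) → ∀ x → R (component x) x
    component-least R-eq h = mergeAll-least R-eq h es

    -- Every vertex has the same label as its representative, by leastness for the equivalence of
    -- having equal labels. Components are compared with other partitions through this universal
    -- property.
    component-≼ : {B : Set} (g : Fin n → B) → (∀ e → A e → g (s e) ≡ g (t e)) → component ≼ g
    component-≼ g h {x} {y} eq = trans (sym (inv x)) (trans (cong g eq) (inv y))
      where
      inv : ∀ x → g (component x) ≡ g x
      inv = component-least (record { refl = refl ; sym = sym ; trans = trans }) h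

-- Levels are refined by adding colours at the head, so a suffix stands for an earlier, coarser
-- level. `drop` leads from the whole list downwards, the direction in which the forests are built.
data Suffix {A : Set} : List A → List A → Set where
  done : ∀ {xs} → Suffix xs xs
  drop : ∀ {x xs ys} → Suffix (x ∷ xs) ys → Suffix xs ys

Suffix-trans : {A : Set} {xs ys zs : List A} → Suffix xs ys → Suffix ys zs → Suffix xs zs
Suffix-trans done     q = q
Suffix-trans (drop p) q = drop (Suffix-trans p q)

Suffix-++ : {A : Set} (xs : List A) {ys : List A} → Suffix ys (xs ++ ys)
Suffix-++ []       = done
Suffix-++ (x ∷ xs) = Suffix-trans (Suffix-++ xs) (drop done)

-- Packing connected spanning subgraphs

module Packing {k n : ℕ} {E : Set} (_≟_ : DecidableEquality E) (s t : E → Fin n) (es : List E) (all∈ : ∀ e → e ∈ es) (unique : Unique es) (x₀ : Fin n) where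

  open Components s t es all∈

  Colouring : Set
  Colouring = E → Fin k

  Within : Colouring → Fin k → (Fin n → Fin n) → E → Set
  Within χ c Q e = χ e ≡ c × Q (s e) ≡ Q (t e)

  Within? : ∀ χ c Q → Decidable (Within χ c Q)
  Within? χ c Q e = (χ e ≟ᶠ c) ×-dec (Q (s e) ≟ᶠ Q (t e))

  -- The sequence of partitions in Kaiser's argument: a single class at first, represented by `x₀`;
  -- then the head colour, applied last, splits each class into the components of its edges inside
  -- that class.
  level : Colouring → List (Fin k) → Fin n → Fin n
  level χ []       = λ _ → x₀
  level χ (c ∷ cs) = component (Within? χ c (level χ cs))

  level-idem : ∀ χ cs → Idem (level χ cs)
  level-idem χ []       x = refl
  level-idem χ (c ∷ cs) = component-idem (Within? χ c (level χ cs))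

  level-≼ : ∀ χ {cs ds} → Suffix cs ds → level χ ds ≼ level χ cs
  level-≼ χ done = id
  level-≼ χ (drop {c} {cs} p) eq = component-≼ (Within? χ c (level χ cs)) (level χ cs) (λ e → proj₂) (level-≼ χ p eq)

  -- The levels are compared lexicographically, as digits in base 1 + n².
  measure : Colouring → List (Fin k) → ℕ
  measure χ []       = 0
  measure χ (c ∷ cs) = separated (level χ (c ∷ cs)) + measure χ cs * suc (n * n)

  -- Coarser levels are the leading digits, and a digit is at most n²; a drop in the leading part
  -- outweighs all later digits.
  measure-extend : ∀ {χ χ′ cs ds} → Suffix cs ds → measure χ′ cs < measure χ cs → measure χ′ ds < measure χ ds
  measure-extend done lt = lt
  measure-extend {χ} {χ′} {cs} (drop {c} p) lt = measure-extend p (begin-strict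
    separated (level χ′ (c ∷ cs)) + measure χ′ cs * suc (n * n)   <⟨ +-monoˡ-< _ (s≤s (separated≤ (level χ′ (c ∷ cs)))) ⟩
    suc (measure χ′ cs) * suc (n * n)                             ≤⟨ *-monoˡ-≤ (suc (n * n)) lt ⟩
    measure χ cs * suc (n * n)                                    ≤⟨ m≤n+m _ _ ⟩
    measure χ (c ∷ cs)                                            ∎)
    where open ≤-Reasoning

  Without : Colouring → E → (Fin n → Fin n) → E → Set
  Without χ e Q e′ = e′ ≢ e × Within χ (χ e) Q e′

  Without? : ∀ χ e Q → Decidable (Without χ e Q)
  Without? χ e Q e′ = ¬? (e′ ≟ e) ×-dec Within? χ (χ e) Q e′

  -- An edge that lies in a class of `level χ cs` but joins two components of colour c there, and whose own colour
  -- stays connected in that class when the edge is removed: giving it colour c coarsens level c ∷ cs.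
  record Redundant (χ : Colouring) (full : List (Fin k)) : Set where
    field
      edge   : E
      colour : Fin k
      below  : List (Fin k)
      suffix : Suffix (colour ∷ below) full
      inside : level χ below (s edge) ≡ level χ below (t edge)
      across : level χ (colour ∷ below) (s edge) ≢ level χ (colour ∷ below) (t edge)
      bypass : component (Without? χ edge (level χ below)) (s edge) ≡ component (Without? χ edge (level χ below)) (t edge)

  recolour : Colouring → E → Fin k → Colouring
  recolour χ e c e′ with e′ ≟ e
  ... | yes _ = c
  ... | no _  = χ e′

  recolour-same : ∀ χ e c → recolour χ e c e ≡ c
  recolour-same χ e c with e ≟ e
  ... | yes _ = refl
  ... | no ne = contradiction refl ne

  recolour-other : ∀ χ e c {e′} → e′ ≢ e → recolour χ e c e′ ≡ χ e′
  recolour-other χ e c {e′} ne with e′ ≟ e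
  ... | yes eq = contradiction eq ne
  ... | no _   = refl

  module _ (χ : Colouring) {full : List (Fin k)} (r : Redundant χ full) where
    open Redundant r renaming (edge to e; colour to c; below to cs)

    improved : Colouring
    improved = recolour χ e c

    -- Induction along the levels. Taking `e` from its old colour breaks no component, since
    -- `bypass` replaces it inside a class of `level χ cs` and hence inside coarser classes. Giving
    -- it colour `c` joins nothing new, since its ends already share a class of `level χ cs`.
    unchanged : ∀ ds → Suffix ds cs → (level χ ds ≼ level improved ds) × (level improved ds ≼ level χ ds)
    unchanged []       p = (λ _ → refl) , (λ _ → refl)
    unchanged (d ∷ ds) p = forward , backward
      where
      Q  = level χ ds
      Q′ = level improved ds
      Q≼Q′ : Q ≼ Q′
      Q≼Q′ = proj₁ (unchanged ds (drop p))
      Q′≼Q : Q′ ≼ Q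
      Q′≼Q = proj₂ (unchanged ds (drop p))

      detour : χ e ≡ d → ∀ e′ → Without χ e (level χ cs) e′ →
               level improved (d ∷ ds) (s e′) ≡ level improved (d ∷ ds) (t e′)
      detour χe≡d e′ (ne , same , eq) = component-joins (Within? improved d Q′) e′
        (trans (recolour-other χ e c ne) (trans same χe≡d) , Q≼Q′ (level-≼ χ (drop p) eq))

      forward : level χ (d ∷ ds) ≼ level improved (d ∷ ds)
      forward = component-≼ (Within? χ d Q) (level improved (d ∷ ds)) kept
        where
        kept : ∀ e′ → Within χ d Q e′ → level improved (d ∷ ds) (s e′) ≡ level improved (d ∷ ds) (t e′)
        kept e′ (col , eq) with e′ ≟ e
        ... | no ne    = component-joins (Within? improved d Q′) e′ (trans (recolour-other χ e c ne) col , Q≼Q′ eq)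
        ... | yes refl = component-≼ (Without? χ e (level χ cs)) (level improved (d ∷ ds)) (detour col) bypass

      backward : level improved (d ∷ ds) ≼ level χ (d ∷ ds)
      backward = component-≼ (Within? improved d Q′) (level χ (d ∷ ds)) kept
        where
        kept : ∀ e′ → Within improved d Q′ e′ → level χ (d ∷ ds) (s e′) ≡ level χ (d ∷ ds) (t e′)
        kept e′ (col , eq) with e′ ≟ e
        ... | no ne    = component-joins (Within? χ d Q) e′ (col , Q′≼Q eq)
        ... | yes refl = level-≼ χ p inside

    unchanged-measure : ∀ ds → Suffix ds cs → measure improved ds ≡ measure χ ds
    unchanged-measure []       p = refl
    unchanged-measure (d ∷ ds) p = cong₂ (λ a b → a + b * suc (n * n))
      (≤-antisym (separated-mono (proj₁ (unchanged (d ∷ ds) p))) (separated-mono (proj₂ (unchanged (d ∷ ds) p))))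
      (unchanged-measure ds (drop p))

    -- The digits up to `cs` stay, and the next one drops because the recoloured edge joins two
    -- classes of level `c ∷ cs`.
    improved-measure : measure improved full < measure χ full
    improved-measure = measure-extend suffix
      (+-mono-<-≤ (separated-strict coarser joined across) (≤-reflexive (cong (_* suc (n * n)) (unchanged-measure cs done))))
      where
      cs≼ : level χ cs ≼ level improved cs
      cs≼ = proj₁ (unchanged cs done)
      joined : level improved (c ∷ cs) (s e) ≡ level improved (c ∷ cs) (t e)
      joined = component-joins (Within? improved c (level improved cs)) e (recolour-same χ e c , cs≼ inside)
      coarser : level χ (c ∷ cs) ≼ level improved (c ∷ cs)
      coarser = component-≼ (Within? χ c (level χ cs)) (level improved (c ∷ cs)) λ e′ (col , eq) →
        component-joins (Within? improved c (level improved cs)) e′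
          -- `e` did not have colour `c` before, as its ends would then have been joined; so colour
          -- `c` loses no edge.
          (trans (recolour-other χ e c λ { refl → across (component-joins (Within? χ c (level χ cs)) e (col , inside)) }) col , cs≼ eq)

  -- Stable partitions: every class is connected in every colour

  Stable : Colouring → (Fin n → Fin n) → Set
  Stable χ P = ∀ c → P ≼ component (Within? χ c P)

  rounds : ℕ → List (Fin k)
  rounds zero    = []
  rounds (suc m) = allFin k ++ rounds m

  -- When the turn of `c` comes, the partition is at least as fine as `level χ cs`, so its split is
  -- at least as fine as a split of `level χ cs` itself. A round that changes nothing therefore
  -- shows stability.
  scheduled-≼ : ∀ χ {c} ds cs → c ∈ ds → level χ (ds ++ cs) ≼ component (Within? χ c (level χ cs))
  scheduled-≼ χ {c} (d ∷ ds) cs (here refl) =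
    component-≼ (Within? χ d (level χ (ds ++ cs))) (component (Within? χ c (level χ cs))) λ e (col , eq) →
      component-joins (Within? χ c (level χ cs)) e (col , level-≼ χ (Suffix-++ ds) eq)
  scheduled-≼ χ (d ∷ ds) cs (there c∈) eq = scheduled-≼ χ ds cs c∈ (level-≼ χ {ds ++ cs} (drop done) eq)

  -- A round applied to a partition that is not stable separates a further pair, so `m` rounds
  -- without success separate at least `m` pairs.
  stable-or-separated : ∀ χ m → (∃ λ cs → Suffix cs (rounds m) × Stable χ (level χ cs)) ⊎ m ≤ separated (level χ (rounds m))
  stable-or-separated χ zero    = inj₂ z≤n
  stable-or-separated χ (suc m) with stable-or-separated χ m
  ... | inj₁ (cs , p , st) = inj₁ (cs , Suffix-trans p (Suffix-++ (allFin k)) , st)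
  ... | inj₂ m≤ with separated (level χ (rounds m)) <? separated (level χ (rounds (suc m)))
  ...   | yes lt = inj₂ (≤-trans (s≤s m≤) lt)
  ...   | no ≮   = inj₁ (rounds m , Suffix-++ (allFin k) , stable)
    where
    stable : Stable χ (level χ (rounds m))
    stable c {x} {y} eq with component (Within? χ c (level χ (rounds m))) x ≟ᶠ component (Within? χ c (level χ (rounds m))) y
    ... | yes eq′ = eq′
    ... | no ne   = contradiction
      (separated-strict (level-≼ χ (Suffix-++ (allFin k))) eq (ne ∘ scheduled-≼ χ (allFin k) (rounds m) (∈-allFin c))) ≮

  -- One round more than the n² ordered pairs, so stability must occur on the way. The list is the
  -- same for all colourings, which makes their measures comparable digit by digit.
  schedule : List (Fin k)
  schedule = rounds (suc (n * n))

  stable-level : ∀ χ → ∃ λ cs → Suffix cs schedule × Stable χ (level χ cs)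
  stable-level χ with stable-or-separated χ (suc (n * n))
  ... | inj₁ st = st
  ... | inj₂ lt = contradiction (separated≤ (level χ schedule)) (<⇒≱ lt)

  crosses? : (P : Fin n → Fin n) → Decidable (λ e → P (s e) ≢ P (t e))
  crosses? P e = ¬? (P (s e) ≟ᶠ P (t e))

  -- Forests of one colour on the classes of a stable partition

  module Forests (χ : Colouring) (st : List (Fin k)) (st⊑ : Suffix st schedule) (stable : Stable χ (level χ st)) where

    P : Fin n → Fin n
    P = level χ st

    -- Only the universal property of a spanning forest on the classes of P is recorded.
    record Forest (A : E → Set) (edges : ℕ) : Set where
      field
        part  : Fin n → Fin n
        idem  : Idem part
        size  : classes part + edges ≤ classes P
        least : (g : Fin n → Fin n) → P ≼ g → (∀ e → A e → g (s e) ≡ g (t e)) → part ≼ g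

    module _ (c : Fin k) where

      crossing : (Fin n → Fin n) → ℕ
      crossing Q = ∑ es λ e → ⟦ Within? χ c Q e ×-dec crosses? P e ⟧

      module _ (d : Fin k) (cs : List (Fin k)) (suffix : Suffix (d ∷ cs) st) where

        fine coarse : Fin n → Fin n
        fine   = level χ (d ∷ cs)
        coarse = level χ cs

        new? : Decidable (λ e → Within χ c coarse e × fine (s e) ≢ fine (t e))
        new? e = Within? χ c coarse e ×-dec crosses? fine e

        -- The new edges are inserted one at a time. An edge between two trees merges them; an edge
        -- that closes a cycle is redundant, with the rest of the cycle as its bypass.
        extend : ∀ ys → Unique ys → Forest (Within χ c fine) (crossing fine) →
                 Redundant χ schedule ⊎
                 Forest (λ e → Within χ c fine e ⊎ e ∈ ys × Within χ c coarse e) (∑ ys (λ e → ⟦ new? e ⟧) + crossing fine)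
        extend []       _ F = inj₂ (record
          { part = part ; idem = idem ; size = size ; least = λ g P≼g h → least g P≼g (λ e → h e ∘ inj₁) })
          where open Forest F
        extend (e ∷ ys) (e∉ ∷ u) F with extend ys u F
        ... | inj₁ r  = inj₁ r
        ... | inj₂ F′ with new? e
        ...   | no old = inj₂ (record
          { part = part ; idem = idem ; size = size
          ; least = λ g P≼g h → least g P≼g λ { e′ (inj₁ w) → h e′ (inj₁ w) ; e′ (inj₂ (i , w)) → h e′ (inj₂ (there i , w)) } })
          where open Forest F′
        ...   | yes ((col , inside) , across) with Forest.part F′ (s e) ≟ᶠ Forest.part F′ (t e)
        ...     | yes eq = inj₁ (record
          { edge = e ; colour = d ; below = cs ; suffix = Suffix-trans suffix st⊑ ; inside = inside ; across = across
          ; bypass = least g P≼g joins eq })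
          where
          open Forest F′
          g : Fin n → Fin n
          g = component (Without? χ e coarse)
          P≼g : P ≼ g
          -- By stability the classes of `P` are connected in colour `c` by edges inside them, and
          -- `e` is none of these: it lies across `fine`, hence across `P`.
          P≼g = component-≼ (Within? χ c P) g (λ e′ (col′ , eq′) → component-joins (Without? χ e coarse) e′
            ((λ { refl → across (level-≼ χ suffix eq′) }) , trans col′ (sym col) , level-≼ χ (drop suffix) eq′)) ∘ stable c
          joins : ∀ e′ → Within χ c fine e′ ⊎ e′ ∈ ys × Within χ c coarse e′ → g (s e′) ≡ g (t e′)
          joins e′ (inj₁ (col′ , eq′)) = component-joins (Without? χ e coarse) e′
            ((λ { refl → across eq′ }) , trans col′ (sym col) , level-≼ χ {cs} (drop done) eq′)
          joins e′ (inj₂ (i , col′ , eq′)) = component-joins (Without? χ e coarse) e′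
            ((λ { refl → All.lookup e∉ i refl }) , trans col′ (sym col) , eq′)
        ...     | no ne = inj₂ (record
          { part  = merge part (s e) (t e)
          ; idem  = merge-idem part (s e) (t e) idem
          ; size  = ≤-trans (≤-reflexive (+-suc (classes (merge part (s e) (t e))) _))
                      (≤-trans (+-monoˡ-≤ _ (merge-classes part (s e) (t e) idem ne)) size)
          ; least = λ g P≼g h {x} {y} eq →
              let old : part ≼ g
                  old = least g P≼g λ { e′ (inj₁ w) → h e′ (inj₁ w) ; e′ (inj₂ (i , w)) → h e′ (inj₂ (there i , w)) }
                  inv = merge-least part (s e) (t e) idem {R = λ x y → g x ≡ g y}
                          (record { refl = refl ; sym = sym ; trans = trans })
                          (≼-absorb idem old) (h e (inj₂ (here refl , col , inside)))
              in trans (sym (inv x)) (trans (cong g eq) (inv y)) })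
          where open Forest F′

        -- A crossing edge inside a coarse class is either new at this level or already counted
        -- inside a fine class.
        coarsen : Forest (Within χ c fine) (crossing fine) → Redundant χ schedule ⊎ Forest (Within χ c coarse) (crossing coarse)
        coarsen F with extend es unique F
        ... | inj₁ r  = inj₁ r
        ... | inj₂ F′ = inj₂ (record
          { part = part ; idem = idem
          ; size = ≤-trans (+-monoʳ-≤ (classes part) count) size
          ; least = λ g P≼g h → least g P≼g λ { e (inj₁ (col , eq)) → h e (col , level-≼ χ {cs} (drop done) eq) ; e (inj₂ (_ , w)) → h e w } })
          where
          open Forest F′
          split : ∀ e → Within χ c coarse e × P (s e) ≢ P (t e) →
                  (Within χ c coarse e × fine (s e) ≢ fine (t e)) ⊎ (Within χ c fine e × P (s e) ≢ P (t e))
          split e (w , x) with fine (s e) ≟ᶠ fine (t e)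
          ... | yes eq = inj₂ ((proj₁ w , eq) , x)
          ... | no ne  = inj₁ (w , ne)
          count : crossing coarse ≤ ∑ es (λ e → ⟦ new? e ⟧) + crossing fine
          count = ≤-trans
            (∑-mono es λ e → ⟦⟧-cover (Within? χ c coarse e ×-dec crosses? P e) (new? e) (Within? χ c fine e ×-dec crosses? P e) (split e))
            (≤-reflexive (∑-+ es (λ e → ⟦ new? e ⟧) _))

      -- Starts at `P`, inside whose classes nothing crosses, and proceeds to coarser levels; at the
      -- empty list all crossing edges of colour `c` are counted.
      forest : ∀ cs → Suffix cs st → Redundant χ schedule ⊎ Forest (Within χ c (level χ cs)) (crossing (level χ cs))
      forest cs done = inj₂ (record
        { part = P ; idem = level-idem χ st
        ; size = ≤-reflexive (trans (cong (classes P +_) none) (+-identityʳ _))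
        ; least = λ g P≼g _ → P≼g })
        where
        none : crossing P ≡ 0
        none = n≤0⇒n≡0 (≤-trans
          (∑-bound es λ e → ≤-reflexive (⟦⟧-false (Within? χ c P e ×-dec crosses? P e) λ ((_ , eq) , ne) → ne eq))
          (≤-reflexive (*-zeroʳ (length es))))
      forest cs (drop {d} p) with forest (d ∷ cs) p
      ... | inj₁ r = inj₁ r
      ... | inj₂ F = coarsen d cs p F

      bottom : Suffix [] st
      bottom = subst (Suffix []) (++-identityʳ st) (Suffix-++ st)

  Coloured? : (χ : Colouring) (c : Fin k) → Decidable (λ e → χ e ≡ c)
  Coloured? χ c e = χ e ≟ᶠ c

  Spanning : Colouring → Fin k → Set
  Spanning χ c = ∀ x y → component (Coloured? χ c) x ≡ component (Coloured? χ c) y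

  -- Counting over all colours, and termination of the recolouring

  module _ (ample : ∀ P {x y} → P x ≢ P y → k * classes P ≤ ∑ es (λ e → ⟦ crosses? P e ⟧) + k) where

    -- Without a redundant edge each colour has fewer than `classes P` crossing edges, and colour
    -- `d` at least one fewer still, as its forest leaves two trees. The sum over the colours
    -- contradicts `ample`.
    improve : (χ : Colouring) (d : Fin k) {x y : Fin n} → component (Coloured? χ d) x ≢ component (Coloured? χ d) y → Redundant χ schedule
    improve χ d {x} {y} apart with stable-level χ
    ... | st , st⊑ , stable with sequence-⊎ (λ c → Forests.forest χ st st⊑ stable c [] (Forests.bottom χ st st⊑ stable c))
    ...   | inj₁ r  = r
    ...   | inj₂ Fs = contradiction (ample (level χ st) (apart ∘ P≼ d)) (<⇒≱ few)
      where
      open Forests χ st st⊑ stable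
      P≼ : ∀ c → P ≼ component (Coloured? χ c)
      P≼ c = component-≼ (Within? χ c P) (component (Coloured? χ c)) (λ e (col , _) → component-joins (Coloured? χ c) e col) ∘ stable c
      X : Fin k → ℕ
      X c = crossing c (λ _ → x₀)

      per-colour : ∀ c → ⟦ d ≟ᶠ c ⟧ + suc (X c) ≤ classes P
      per-colour c with d ≟ᶠ c
      ... | no _     = ≤-trans (+-monoˡ-≤ (X c) (1≤classes idem x)) size
        where open Forest (Fs c)
      -- The trees of colour `d` lie inside the components of that colour, which separate `x` from
      -- `y`.
      ... | yes refl = ≤-trans (+-monoˡ-≤ (X c) (2≤classes idem (apart ∘ part≼))) size
        where
        open Forest (Fs c)
        part≼ : part ≼ component (Coloured? χ c)
        part≼ = least _ (P≼ c) (λ e (col , _) → component-joins (Coloured? χ c) e col)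

      ∑X : ∑ es (λ e → ⟦ crosses? P e ⟧) ≤ ∑ (allFin k) X
      ∑X = ≤-trans
        (∑-mono es λ e → ≤-trans
          (⟦⟧-mono (crosses? P e) (Within? χ (χ e) (λ _ → x₀) e ×-dec crosses? P e) ((refl , refl) ,_))
          (∑-member (λ c → ⟦ Within? χ c (λ _ → x₀) e ×-dec crosses? P e ⟧) (∈-allFin (χ e))))
        (≤-reflexive (∑-swap es (allFin k) _))

      few : ∑ es (λ e → ⟦ crosses? P e ⟧) + k < k * classes P
      few = begin-strict
        ∑ es (λ e → ⟦ crosses? P e ⟧) + k                                         ≤⟨ +-monoˡ-≤ k ∑X ⟩
        ∑ (allFin k) X + k                                                        ≡⟨ +-comm _ k ⟩
        k + ∑ (allFin k) X                                                        ≡⟨ cong (_+ ∑ (allFin k) X) (trans (∑-const (allFin k) 1) (trans (*-identityʳ _) (length-tabulate id))) ⟨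
        ∑ (allFin k) (λ _ → 1) + ∑ (allFin k) X                                   ≡⟨ ∑-+ (allFin k) (λ _ → 1) X ⟨
        ∑ (allFin k) (λ c → suc (X c))                                            <⟨ +-monoˡ-≤ _ (∑-indicator≥1 _≟ᶠ_ (∈-allFin d)) ⟩
        ∑ (allFin k) (λ c → ⟦ d ≟ᶠ c ⟧) + ∑ (allFin k) (λ c → suc (X c))          ≡⟨ ∑-+ (allFin k) (λ c → ⟦ d ≟ᶠ c ⟧) (λ c → suc (X c)) ⟨
        ∑ (allFin k) (λ c → ⟦ d ≟ᶠ c ⟧ + suc (X c))                               ≤⟨ ∑-bound (allFin k) per-colour ⟩
        length (allFin k) * classes P                                             ≡⟨ cong (_* classes P) (length-tabulate {n = k} id) ⟩
        k * classes P                                                             ∎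
        where open ≤-Reasoning

    pack : (χ : Colouring) → Acc _<_ (measure χ schedule) → ∃ λ χ′ → ∀ c → Spanning χ′ c
    pack χ (acc rec) with all? (λ c → all? λ x → all? λ y → component (Coloured? χ c) x ≟ᶠ component (Coloured? χ c) y)
    ... | yes spanning = χ , spanning
    ... | no ¬spanning with ¬∀⟶∃¬ k _ (λ c → all? λ x → all? λ y → component (Coloured? χ c) x ≟ᶠ component (Coloured? χ c) y) ¬spanning
    ...   | d , ¬∀ with ¬∀⟶∃¬ n _ (λ x → all? λ y → component (Coloured? χ d) x ≟ᶠ component (Coloured? χ d) y) ¬∀
    ...     | x , ¬∀y with ¬∀⟶∃¬ n _ (λ y → component (Coloured? χ d) x ≟ᶠ component (Coloured? χ d) y) ¬∀y
    ...       | y , apart = pack (improved χ r) (rec (improved-measure χ r))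
      where
      r : Redundant χ schedule
      r = improve χ d apart

does-true : {A : Set} (a? : Dec A) → does a? ≡ true → A
does-true (yes a) _ = a

-- Walks

Walk-trans : {V : Set} {R : V → V → Set} {a b c : V} → Walk R a b → Walk R b c → Walk R a c
Walk-trans here       q = q
Walk-trans (step r p) q = step r (Walk-trans p q)

Walk-sym : {V : Set} {R : V → V → Set} → (∀ {a b} → R a b → R b a) → ∀ {a b} → Walk R a b → Walk R b a
Walk-sym R-sym here       = here
Walk-sym R-sym (step r p) = Walk-trans (Walk-sym R-sym p) (step (R-sym r) here)

Walk-invariant : {V B : Set} {R : V → V → Set} (g : V → B) → (∀ {a b} → R a b → g a ≡ g b) → ∀ {a b} → Walk R a b → g a ≡ g b
Walk-invariant g h here       = refl
Walk-invariant g h (step r p) = trans (h r) (Walk-invariant g h p)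

-- Spanning trees given by parent maps

module RootedTree (H : Graph) (ρ : Graph.V H) (π : Graph.V H → Graph.V H) (rank : Graph.V H → ℕ) (π-adj : ∀ {a} → a ≢ ρ → Graph.Adj H a (π a)) (π-rank : ∀ {a} → a ≢ ρ → rank (π a) < rank a) where

  open Graph H

  Up : V → V → Set
  Up a b = a ≢ ρ × π a ≡ b

  up? : ∀ a b → Dec (Up a b)
  up? a b = ¬? (a ≟ ρ) ×-dec (π a ≟ b)

  link? : ∀ a b → Dec (Up a b ⊎ Up b a)
  link? a b = up? a b ⊎-dec up? b a

  tree : V → V → Bool
  tree a b = does (link? a b)

  _~_ : V → V → Set
  a ~ b = tree a b ≡ true

  tree⁻ : ∀ {a b} → a ~ b → Up a b ⊎ Up b a
  tree⁻ {a} {b} = does-true (link? a b)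

  tree⁺ : ∀ {a b} → Up a b ⊎ Up b a → a ~ b
  tree⁺ {a} {b} = dec-true (link? a b)

  up-adj : ∀ {a b} → Up a b → Adj a b
  up-adj (a≢ρ , refl) = π-adj a≢ρ

  up-rank : ∀ {a b} → Up a b → rank b < rank a
  up-rank (a≢ρ , refl) = π-rank a≢ρ

  tree-sym : ∀ a b → tree a b ≡ tree b a
  tree-sym a b = ∨-comm (does (up? a b)) (does (up? b a))

  to-root : ∀ a → Acc _<_ (rank a) → Walk _~_ a ρ
  to-root a (acc rec) with a ≟ ρ
  ... | yes refl = here
  ... | no a≢ρ   = step (tree⁺ (inj₁ (a≢ρ , refl))) (to-root (π a) (rec (π-rank a≢ρ)))

  connected : ∀ a b → Walk _~_ a b
  connected a b = Walk-trans (to-root a (<-wellFounded _)) (Walk-sym (λ {u} {w} → trans (tree-sym w u)) (to-root b (<-wellFounded _)))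

  start∈ : ∀ {a b} (p : Walk _~_ a b) → a ∈ verts p
  start∈ here       = here refl
  start∈ (step _ p) = here refl

  -- A path that has once gone down can never turn up again: it would return along the edge it came by.
  descends : ∀ {u w v} → Up w u → (q : Walk _~_ w v) → IsPath q → u ∉ verts q → rank w ≤ rank v
  descends w↑u here       _         _  = ≤-refl
  descends w↑u (step r q) (w∉ ∷ pq) u∉ with tree⁻ r
  ... | inj₁ w↑x = contradiction (there (subst (_∈ verts q) (trans (sym (proj₂ w↑x)) (proj₂ w↑u)) (start∈ q))) u∉
  ... | inj₂ x↑w = ≤-trans (<⇒≤ (up-rank x↑w)) (descends x↑w q pq (λ w∈ → All.lookup w∉ w∈ refl))

  -- A last step that goes down comes from the parent of `v`. If it goes up, no earlier step went
  -- down, and the rank falls along the whole path.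
  ascends-or-ends-down : ∀ {u v} (p : Walk _~_ u v) → IsPath p → 1 ≤ wlen p → rank v < rank u ⊎ π v ∈ verts p
  ascends-or-ends-down (step r here) _ _ with tree⁻ r
  ... | inj₁ u↑v = inj₁ (up-rank u↑v)
  ... | inj₂ v↑u = inj₂ (here (proj₂ v↑u))
  ascends-or-ends-down (step r q@(step _ _)) (u∉ ∷ pq) _ with ascends-or-ends-down q pq (s≤s z≤n)
  ... | inj₂ ∈q = inj₂ (there ∈q)
  ... | inj₁ lt with tree⁻ r
  ...   | inj₁ u↑w = inj₁ (<-trans lt (up-rank u↑w))
  ...   | inj₂ w↑u = contradiction lt (≤⇒≯ (descends w↑u q pq (λ u∈ → All.lookup u∉ u∈ refl)))

  -- According to the directions of the edge `a b` and of the first step, there is a strict cycle of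
  -- ranks, a second visit to `b`, or a path of positive length from `a` to itself.
  acyclic : ∀ a b → a ~ b → (p : Walk _~_ b a) → IsPath p → ¬ (2 ≤ wlen p)
  acyclic a b a~b (step {w = w} r q) (b∉ ∷ pq) (s≤s 1≤) with tree⁻ a~b | tree⁻ r | ascends-or-ends-down q pq 1≤
  ... | inj₁ a↑b | _        | inj₂ πa∈ = All.lookup b∉ πa∈ (sym (proj₂ a↑b))
  ... | inj₁ a↑b | inj₁ b↑w | inj₁ lt  = <-asym (up-rank a↑b) (<-trans lt (up-rank b↑w))
  ... | _        | inj₂ w↑b | inj₁ lt  = ≤⇒≯ (descends w↑b q pq (λ b∈ → All.lookup b∉ b∈ refl)) lt
  ... | inj₂ b↑a | inj₂ w↑b | inj₂ _   =
    <-asym (up-rank b↑a) (<-≤-trans (up-rank w↑b) (descends w↑b q pq (λ b∈ → All.lookup b∉ b∈ refl)))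
  ... | inj₂ b↑a | inj₁ b↑w | _        = closed q pq 1≤ (trans (sym (proj₂ b↑w)) (proj₂ b↑a))
    where
    end∈ : ∀ {u v} (q : Walk _~_ u v) → v ∈ verts q
    end∈ here       = here refl
    end∈ (step _ q) = there (end∈ q)
    closed : ∀ {u v} (q : Walk _~_ u v) → IsPath q → 1 ≤ wlen q → u ≢ v
    closed (step _ q) (u∉ ∷ _) _ = All.lookup u∉ (end∈ q)

  isSpanningTree : IsSpanningTree H tree
  isSpanningTree = (λ a b → [ up-adj , Adj-sym ∘ up-adj ]′ ∘ tree⁻) , tree-sym , connected , acyclic

  -- An inner vertex has two distinct neighbours on the path, and only one of them can be its
  -- parent; another one is a child.
  interior-is-parent : ∀ {u v} (p : Walk _~_ u v) → IsPath p → ∀ {x} → x ∈ verts p → (x ≡ u ⊎ x ≡ v) ⊎ (∃ λ y → Up y x)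
  interior-is-parent here       _         (here eq)  = inj₁ (inj₁ eq)
  interior-is-parent (step r q) _         (here eq)  = inj₁ (inj₁ eq)
  interior-is-parent (step r q) (u∉ ∷ pq) (there x∈) with interior-is-parent q pq x∈
  ... | inj₁ (inj₂ eq)   = inj₁ (inj₂ eq)
  ... | inj₂ up          = inj₂ up
  ... | inj₁ (inj₁ refl) = second r q u∉
    where
    second : ∀ {u w v} → u ~ w → (q : Walk _~_ w v) → All (u ≢_) (verts q) → (w ≡ u ⊎ w ≡ v) ⊎ (∃ λ y → Up y w)
    second r here        u∉ = inj₁ (inj₂ refl)
    second r (step r′ q) u∉ with tree⁻ r | tree⁻ r′
    ... | inj₁ u↑w | _        = inj₂ (_ , u↑w)
    ... | _        | inj₂ x↑w = inj₂ (_ , x↑w)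
    ... | inj₂ w↑u | inj₁ w↑x =
      contradiction (trans (sym (proj₂ w↑u)) (proj₂ w↑x)) (All.lookup u∉ (there (start∈ q)))

-- Completely independent spanning trees from connected spanning colour classes

module Trees {k n : ℕ} (H : Graph) (s t : Graph.V H → Fin n) (es : List (Graph.V H)) (all∈ : ∀ e → e ∈ es) (χ : Graph.V H → Fin k) where

  open Graph H

  Inc : Fin n → V → Set
  Inc x e = x ≡ s e ⊎ x ≡ t e

  Ends : V → Fin n → Fin n → Set
  Ends e x y = (s e ≡ x × t e ≡ y) ⊎ (s e ≡ y × t e ≡ x)

  Ends-incˡ : ∀ {e x y} → Ends e x y → Inc x e
  Ends-incˡ (inj₁ (p , _)) = inj₁ (sym p)
  Ends-incˡ (inj₂ (_ , p)) = inj₂ (sym p)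

  Ends-incʳ : ∀ {e x y} → Ends e x y → Inc y e
  Ends-incʳ (inj₁ (_ , p)) = inj₂ (sym p)
  Ends-incʳ (inj₂ (p , _)) = inj₁ (sym p)

  -- Connectivity of colour `c` in terms of cuts: every vertex set that no edge of colour `c` leaves
  -- is empty or everything.
  Linked : Fin k → Set
  Linked c = (g : Fin n → Bool) → (∀ e → χ e ≡ c → g (s e) ≡ g (t e)) → ∀ x y → g x ≡ g y

  boundary-edge : ∀ c → Linked c → (g : Fin n → Bool) → ∀ {x y} → g x ≡ true → g y ≡ false →
                  ∃ λ e → χ e ≡ c × ∃₂ λ a b → Ends e a b × g a ≡ true × g b ≡ false
  boundary-edge c linked g {x} {y} gx gy with Any.any? (λ e → (χ e ≟ᶠ c) ×-dec ¬? (g (s e) ≟ᵇ g (t e))) es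
  ... | no none = contradiction
    (trans (sym gx) (trans (linked g (λ e col → decidable-stable (g (s e) ≟ᵇ g (t e)) λ ne → none (lose (all∈ e) (col , ne))) x y) gy))
    λ ()
  ... | yes some with find some
  ...   | e , _ , col , ne with g (s e) in gs | g (t e) in gt
  ...     | true  | true  = contradiction refl ne
  ...     | false | false = contradiction refl ne
  ...     | true  | false = e , col , s e , t e , inj₁ (refl , refl) , gs , gt
  ...     | false | true  = e , col , t e , s e , inj₂ (refl , refl) , gt , gs

  -- `dist` need not be the graph distance; it only has to fall along some edge of colour `c` that
  -- stays in the set `g`.
  Descends : Fin k → Fin n → (Fin n → ℕ) → (Fin n → Bool) → Set
  Descends c r dist g = ∀ x → g x ≡ true → x ≢ r → ∃₂ λ e y → χ e ≡ c × Ends e x y × g y ≡ true × dist y < dist x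

  module _ (c : Fin k) (linked : Linked c) (r : Fin n) where

    outside : (Fin n → Bool) → ℕ
    outside g = ∑ (allFin n) λ x → ⟦ g x ≟ᵇ false ⟧

    -- Search from `r`: the far end `b` of a boundary edge joins the set, with a value one above
    -- that of `a`.
    grow : ∀ dist g → g r ≡ true → Descends c r dist g → Acc _<_ (outside g) →
           ∃₂ λ dist′ g′ → (∀ x → g′ x ≡ true) × Descends c r dist′ g′
    grow dist g gr desc (acc rec) with any? (λ x → g x ≟ᵇ false)
    ... | no none = dist , g , (λ x → full (g x) (λ eq → none (x , eq))) , desc
      where
      full : ∀ b → b ≢ false → b ≡ true
      full true  _  = refl
      full false ne = contradiction refl ne
    ... | yes (z , gz) with boundary-edge c linked g gr gz
    ...   | e , col , a , b , ends , ga , gb = grow dist′ g′ (g⊆g′ gr) desc′ (rec fewer)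
      where
      dist′ : Fin n → ℕ
      dist′ x with x ≟ᶠ b
      ... | yes _ = suc (dist a)
      ... | no _  = dist x
      g′ : Fin n → Bool
      g′ x with x ≟ᶠ b
      ... | yes _ = true
      ... | no _  = g x
      g≢b : ∀ {x} → g x ≡ true → x ≢ b
      g≢b gx refl = contradiction (trans (sym gx) gb) λ ()
      g⊆g′ : ∀ {x} → g x ≡ true → g′ x ≡ true
      g⊆g′ {x} gx with x ≟ᶠ b
      ... | yes _ = refl
      ... | no _  = gx
      dist′≡ : ∀ {x} → g x ≡ true → dist′ x ≡ dist x
      dist′≡ {x} gx with x ≟ᶠ b
      ... | yes eq = contradiction eq (g≢b gx)
      ... | no _   = refl
      desc′ : Descends c r dist′ g′
      desc′ x g′x x≢r with x ≟ᶠ b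
      ... | yes refl = e , a , col , swap ends , g⊆g′ ga , s≤s (≤-reflexive (dist′≡ ga))
      ... | no _ with desc x g′x x≢r
      ...   | e′ , y , col′ , ends′ , gy , lt = e′ , y , col′ , ends′ , g⊆g′ gy , subst (_< dist x) (sym (dist′≡ gy)) lt
      fewer : outside g′ < outside g
      fewer = ∑-strict
        (λ x → ⟦⟧-mono (g′ x ≟ᵇ false) (g x ≟ᵇ false) (back x))
        (∈-allFin b) (⟦⟧-strict (g′ b ≟ᵇ false) (g b ≟ᵇ false) (λ eq → contradiction (trans (sym g′b) eq) λ ()) gb)
        where
        g′b : g′ b ≡ true
        g′b with b ≟ᶠ b
        ... | yes _ = refl
        ... | no ne = contradiction refl ne
        back : ∀ x → g′ x ≡ false → g x ≡ false
        back x eq with x ≟ᶠ b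
        ... | no _ = eq
        back x () | yes _

    abstract
      distance : Σ (Fin n → ℕ) λ dist → ∀ x → x ≢ r → ∃₂ λ e y → χ e ≡ c × Ends e x y × dist y < dist x
      distance with grow (λ _ → 0) (λ x → does (x ≟ᶠ r)) (dec-true (r ≟ᶠ r) refl)
                         (λ x g x≢r → contradiction (does-true (x ≟ᶠ r) g) x≢r) (<-wellFounded _)
      ... | dist , g , all , desc = dist , λ x x≢r →
        let e , y , col , ends , _ , lt = desc x (all x) x≢r in e , y , col , ends , lt

  module _ (linked : ∀ c → Linked c) {x₀ y₀ : Fin n} (x₀≢y₀ : x₀ ≢ y₀)
           (loopless : ∀ e → s e ≢ t e)
           (simple : ∀ {x y a b} → x ≢ y → Inc x a → Inc y a → Inc x b → Inc y b → a ≡ b)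
           (adjacent : ∀ {x a b} → a ≢ b → Inc x a → Inc x b → Adj a b) where

    abstract
      -- An edge of colour `c` must leave the set consisting of `x₀` alone, because `y₀` lies
      -- outside it.
      star : ∀ c → ∃₂ λ e y → χ e ≡ c × Ends e x₀ y
      star c with boundary-edge c (linked c) (λ x → does (x ≟ᶠ x₀)) {x₀} {y₀} (dec-true (x₀ ≟ᶠ x₀) refl) (dec-false (y₀ ≟ᶠ x₀) (x₀≢y₀ ∘ sym))
      ... | e , col , a , b , ends , ga , _ with a ≟ᶠ x₀
      ...   | yes refl = e , b , col , ends
      star c | e , col , a , b , ends , () , _ | no _

    rootEdge : Fin k → V
    rootEdge c = proj₁ (star c)

    -- The roots are distinct since the trees leave x₀ along different edges.
    root : Fin k → Fin n
    root c = proj₁ (proj₂ (star c))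

    rootEdge-colour : ∀ c → χ (rootEdge c) ≡ c
    rootEdge-colour c = proj₁ (proj₂ (proj₂ (star c)))

    rootEdge-ends : ∀ c → Ends (rootEdge c) x₀ (root c)
    rootEdge-ends c = proj₂ (proj₂ (proj₂ (star c)))

    Ends-≢ : ∀ {e x y} → Ends e x y → x ≢ y
    Ends-≢ {e} (inj₁ (refl , refl)) = loopless e
    Ends-≢ {e} (inj₂ (refl , refl)) = loopless e ∘ sym

    -- Equal roots give two root edges with the same ends; by simplicity they coincide, and so do
    -- their colours.
    root-injective : ∀ {c d} → root c ≡ root d → c ≡ d
    root-injective {c} {d} eq = trans (sym (rootEdge-colour c)) (trans (cong χ same) (rootEdge-colour d))
      where
      same : rootEdge c ≡ rootEdge d
      same = simple (Ends-≢ (rootEdge-ends c)) (Ends-incˡ (rootEdge-ends c)) (Ends-incʳ (rootEdge-ends c))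
               (Ends-incˡ (rootEdge-ends d)) (subst (λ x → Inc x (rootEdge d)) (sym eq) (Ends-incʳ (rootEdge-ends d)))

    dist : Fin k → Fin n → ℕ
    dist c = proj₁ (distance c (linked c) (root c))

    towards : ∀ c x → x ≢ root c → ∃₂ λ e y → χ e ≡ c × Ends e x y × dist c y < dist c x
    towards c = proj₂ (distance c (linked c) (root c))

    head : V → Fin n
    head e with dist (χ e) (s e) <? dist (χ e) (t e)
    ... | yes _ = s e
    ... | no _  = t e

    head-inc : ∀ e → Inc (head e) e
    head-inc e with dist (χ e) (s e) <? dist (χ e) (t e)
    ... | yes _ = inj₁ refl
    ... | no _  = inj₂ refl

    head-closer : ∀ {c e x y} → χ e ≡ c → Ends e x y → dist c y < dist c x → head e ≡ y
    head-closer {e = e} refl ends lt with dist (χ e) (s e) <? dist (χ e) (t e) | ends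
    ... | yes lt′ | inj₁ (refl , refl) = contradiction lt′ (<-asym lt)
    ... | yes _   | inj₂ (refl , refl) = refl
    ... | no _    | inj₁ (refl , refl) = refl
    ... | no ≮    | inj₂ (refl , refl) = contradiction lt ≮

    -- At the root no vertex is nearer, and the root edge takes the place of the next edge; all
    -- branches of tree `c` thus end in `rootEdge c`.
    exit : Fin k → Fin n → V
    exit c x with x ≟ᶠ root c
    ... | yes _ = rootEdge c
    ... | no ne = proj₁ (towards c x ne)

    exit-colour : ∀ c x → χ (exit c x) ≡ c
    exit-colour c x with x ≟ᶠ root c
    ... | yes _ = rootEdge-colour c
    ... | no ne = proj₁ (proj₂ (proj₂ (towards c x ne)))

    exit-inc : ∀ c x → Inc x (exit c x)
    exit-inc c x with x ≟ᶠ root c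
    ... | yes refl = Ends-incʳ (rootEdge-ends c)
    ... | no ne    = Ends-incˡ (proj₁ (proj₂ (proj₂ (proj₂ (towards c x ne)))))

    exit-root : ∀ c → exit c (root c) ≡ rootEdge c
    exit-root c with root c ≟ᶠ root c
    ... | yes _ = refl
    ... | no ne = contradiction refl ne

    exit-closer : ∀ c x → x ≢ root c → dist c (head (exit c x)) < dist c x
    exit-closer c x x≢r with x ≟ᶠ root c
    ... | yes eq = contradiction eq x≢r
    ... | no ne  = let e , y , col , ends , lt = towards c x ne in
                   subst (λ z → dist c z < dist c x) (sym (head-closer col ends lt)) lt

    parent : Fin k → V → V
    parent c e = exit c (head e)

    rank : Fin k → V → ℕ
    rank c e with e ≟ rootEdge c | χ e ≟ᶠ c
    ... | yes _ | _     = 0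
    ... | no _  | yes _ = 1 + dist c (head e)
    ... | no _  | no _  = 2 + dist c (head e)

    -- The exit has colour `c` and, unless it is the root edge, a head nearer to the root than `x`;
    -- so its rank is at most `dist c x`.
    rank-exit : ∀ c x → rank c (exit c x) < 1 + dist c x
    rank-exit c x with exit c x ≟ rootEdge c | χ (exit c x) ≟ᶠ c
    ... | yes _ | _     = s≤s z≤n
    ... | no _  | no ne = contradiction (exit-colour c x) ne
    ... | no ne | yes _ = s≤s (exit-closer c x λ { refl → ne (exit-root c) })

    parent-rank : ∀ c {e} → e ≢ rootEdge c → rank c (parent c e) < rank c e
    parent-rank c {e} ne with e ≟ rootEdge c | χ e ≟ᶠ c
    ... | yes eq | _     = contradiction eq ne
    ... | no _   | yes _ = rank-exit c (head e)
    ... | no _   | no _  = m<n⇒m<1+n (rank-exit c (head e))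

    -- Both edges contain `head e`, and the falling rank keeps them distinct.
    parent-adj : ∀ c {e} → e ≢ rootEdge c → Adj e (parent c e)
    parent-adj c {e} ne = adjacent (λ eq → <-irrefl (cong (rank c) (sym eq)) (parent-rank c ne)) (head-inc e) (exit-inc c (head e))

    module Tree (c : Fin k) = RootedTree H (rootEdge c) (parent c) (rank c) (parent-adj c) (parent-rank c)

    -- Each of the two edges contains both heads. If the heads differ, simplicity gives `a ≡ b`, an
    -- edge with two colours. If they agree, each edge is an exit at its own head, which happens
    -- only at the root of its colour; then two roots coincide.
    no-mutual-parents : ∀ {c d a b} → c ≢ d → parent d a ≡ b → parent c b ≡ a → ⊥
    no-mutual-parents {c} {d} {a} {b} c≢d pa≡b pb≡a with head a ≟ᶠ head b
    ... | no ne = c≢d (trans (sym (trans (cong χ (sym pb≡a)) (exit-colour c (head b)))) (trans (cong χ a≡b) (trans (cong χ (sym pa≡b)) (exit-colour d (head a)))))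
      where
      a≡b : a ≡ b
      a≡b = simple ne (head-inc a) (subst (Inc (head b)) pb≡a (exit-inc c (head b)))
              (subst (Inc (head a)) pa≡b (exit-inc d (head a))) (head-inc b)
    ... | yes eq with head a ≟ᶠ root c
    ...   | no ne = <-irrefl (cong (dist c) (cong head (trans (cong (exit c) eq) pb≡a))) (exit-closer c (head a) ne)
    ...   | yes ra with head b ≟ᶠ root d
    ...     | no ne  = <-irrefl (cong (dist d) (cong head (trans (cong (exit d) (sym eq)) pa≡b))) (exit-closer d (head b) ne)
    ...     | yes rb = c≢d (root-injective (trans (sym ra) (trans eq rb)))

    Up-colour : ∀ {c a b} → Tree.Up c a b → χ b ≡ c
    Up-colour {c} {a} (_ , refl) = exit-colour c (head a)

    edge-disjoint : ∀ {c d a b} → c ≢ d → Tree.tree c a b ≡ true → ¬ Tree.tree d a b ≡ true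
    edge-disjoint {c} {d} c≢d p q with Tree.tree⁻ c p | Tree.tree⁻ d q
    ... | inj₁ u | inj₁ v = c≢d (trans (sym (Up-colour u)) (Up-colour v))
    ... | inj₂ u | inj₂ v = c≢d (trans (sym (Up-colour u)) (Up-colour v))
    ... | inj₁ u | inj₂ v = no-mutual-parents c≢d (proj₂ v) (proj₂ u)
    ... | inj₂ u | inj₁ v = no-mutual-parents c≢d (proj₂ v) (proj₂ u)

    wedge-related : ∀ {R : V → V → Set} {u v} (p : Walk R u v) {a b} → (a , b) ∈ wedges p → R a b
    wedge-related (step r p) (here refl) = r
    wedge-related (step r p) (there i)   = wedge-related p i

    independent : ∀ c d → c ≢ d → CompletelyIndependent H (Tree.tree c) (Tree.tree d)
    independent c d c≢d u v u≢v P P-path Q Q-path =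
      (λ a b i → [ edge-disjoint c≢d (wedge-related P i) ∘ wedge-related Q
                 , edge-disjoint c≢d (wedge-related P i) ∘ trans (Tree.tree-sym d a b) ∘ wedge-related Q ]′) ,
      shared
      where
      shared : ∀ x → x ∈ verts P → x ∈ verts Q → x ≡ u ⊎ x ≡ v
      shared x x∈P x∈Q with Tree.interior-is-parent c P P-path x∈P | Tree.interior-is-parent d Q Q-path x∈Q
      ... | inj₁ end      | _             = end
      ... | _             | inj₁ end      = end
      -- An inner vertex of both paths is a parent in both trees and would have both colours.
      ... | inj₂ (_ , u↑) | inj₂ (_ , v↑) = contradiction (trans (sym (Up-colour u↑)) (Up-colour v↑)) c≢d

    hasCISTs : HasCISTs H k
    hasCISTs = Tree.tree , Tree.isSpanningTree , independent

-- Enumerating subtypes cut out by a Boolean predicate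

module _ {A : Set} (b : A → Bool) where

  select : List A → List (Σ A (T ∘ b))
  select []       = []
  select (x ∷ xs) with T? (b x)
  ... | yes p = (x , p) ∷ select xs
  ... | no _  = select xs

  Σ-T-≡ : {p q : Σ A (T ∘ b)} → proj₁ p ≡ proj₁ q → p ≡ q
  Σ-T-≡ {x , p} {_ , q} refl = cong (x ,_) (T-irrelevant p q)

  ∈-select⁺ : ∀ {xs} (p : Σ A (T ∘ b)) → proj₁ p ∈ xs → p ∈ select xs
  ∈-select⁺ {x ∷ xs} (y , p) (here refl) with T? (b x)
  ... | yes q = here (Σ-T-≡ refl)
  ... | no ¬p = contradiction p ¬p
  ∈-select⁺ {x ∷ xs} p (there i) with T? (b x)
  ... | yes _ = there (∈-select⁺ p i)
  ... | no _  = ∈-select⁺ p i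

  select-All : {Q : A → Set} {xs : List A} → All Q xs → All (Q ∘ proj₁) (select xs)
  select-All []                 = []
  select-All {xs = x ∷ _} (q ∷ qs) with T? (b x)
  ... | yes _ = q ∷ select-All qs
  ... | no _  = select-All qs

  select-Unique : ∀ {xs} → Unique xs → Unique (select xs)
  select-Unique []                 = []
  select-Unique {x ∷ _} (x∉ ∷ u) with T? (b x)
  ... | yes _ = All.map (_∘ cong proj₁) (select-All x∉) ∷ select-Unique u
  ... | no _  = select-Unique u

  -- Each entry that is dropped contributes at most one to the sum.
  ∑-select : (f : A → ℕ) → (∀ x → f x ≤ 1) → ∀ xs → ∑ xs f ≤ ∑ (select xs) (f ∘ proj₁) + length (filter (¬? ∘ T? ∘ b) xs)
  ∑-select f f≤1 []       = z≤n
  ∑-select f f≤1 (x ∷ xs) with T? (b x)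
  ... | yes p rewrite filter-reject (¬? ∘ T? ∘ b) {xs = xs} (λ ¬p → ¬p p) =
    ≤-trans (+-monoʳ-≤ (f x) (∑-select f f≤1 xs)) (≤-reflexive (sym (+-assoc (f x) _ _)))
  ... | no ¬p rewrite filter-accept (¬? ∘ T? ∘ b) {xs = xs} ¬p =
    ≤-trans (+-mono-≤ (f≤1 x) (∑-select f f≤1 xs)) (≤-reflexive (sym (+-suc _ _)))

-- Edges of a simple graph

module Edges {n : ℕ} (G : SimpleGraph n) where
  open SimpleGraph G

  private
    _≟ₑ_ : DecidableEquality (Edge G)
    _≟ₑ_ = _≟ᴱ_ G

  open DecMembership _≟ₑ_ using (_∈?_)

  src tgt : Edge G → Fin n
  src e = proj₁ (proj₁ e)
  tgt e = proj₂ (proj₁ e)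

  isEdge : Fin n × Fin n → Bool
  isEdge uv = (toℕ (proj₁ uv) <ᵇ toℕ (proj₂ uv)) ∧ adj (proj₁ uv) (proj₂ uv)

  edges : List (Edge G)
  edges = select isEdge (cartesianProduct (allFin n) (allFin n))

  ∈-edges : ∀ e → e ∈ edges
  ∈-edges e = ∈-select⁺ isEdge e (∈-cartesianProduct⁺ (∈-allFin (src e)) (∈-allFin (tgt e)))

  edges-Unique : Unique edges
  edges-Unique = select-Unique isEdge (cartesianProduct⁺ (allFin⁺ n) (allFin⁺ n))

  src<tgt : ∀ e → toℕ (src e) < toℕ (tgt e)
  src<tgt (uv , p) = <ᵇ⇒< _ _ (proj₁ (Equivalence.to T-∧ p))

  edge-adj : ∀ e → adj (src e) (tgt e) ≡ true
  edge-adj (uv , p) = Equivalence.to T-≡ (proj₂ (Equivalence.to (T-∧ {toℕ (proj₁ uv) <ᵇ toℕ (proj₂ uv)}) p))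

  loopless : ∀ e → src e ≢ tgt e
  loopless e eq = <-irrefl (cong toℕ eq) (src<tgt e)

  edge-between : ∀ {u v} → adj u v ≡ true → ∃ (Hits G u v)
  edge-between {u} {v} uv with <-cmp (toℕ u) (toℕ v)
  ... | tri< lt _ _ = ((u , v) , Equivalence.from T-∧ (<⇒<ᵇ lt , Equivalence.from T-≡ uv)) , inj₁ refl
  ... | tri> _ _ gt = ((v , u) , Equivalence.from T-∧ (<⇒<ᵇ gt , Equivalence.from T-≡ (trans (adj-sym v u) uv))) , inj₂ refl
  ... | tri≈ _ eq _ with toℕ-injective eq
  ...   | refl = contradiction (trans (sym uv) (adj-irrefl u)) λ ()

  hits-self : ∀ e {f} → Hits G (src e) (tgt e) f → f ≡ e
  hits-self e     (inj₁ eq) = Σ-T-≡ isEdge eq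
  hits-self e {f} (inj₂ eq) = contradiction (src<tgt e)
    (<-asym (subst (λ uv → toℕ (proj₁ uv) < toℕ (proj₂ uv)) eq (src<tgt f)))

  hits-of-ends : ∀ {x y} e → x ≢ y → x ≡ src e ⊎ x ≡ tgt e → y ≡ src e ⊎ y ≡ tgt e → Hits G x y e
  hits-of-ends e x≢y (inj₁ refl) (inj₁ refl) = contradiction refl x≢y
  hits-of-ends e x≢y (inj₁ refl) (inj₂ refl) = inj₁ refl
  hits-of-ends e x≢y (inj₂ refl) (inj₁ refl) = inj₂ refl
  hits-of-ends e x≢y (inj₂ refl) (inj₂ refl) = contradiction refl x≢y

  hits-unique : ∀ {x y} e f → Hits G x y e → Hits G x y f → e ≡ f
  hits-unique e f (inj₁ refl) h = sym (hits-self e {f} h)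
  hits-unique e f (inj₂ refl) h = sym (hits-self e {f} (swap h))

  -- Every neighbour of `v` is the far end of an edge in `F`, and an edge has only one far end.
  isolated-degree : ∀ F v → (∀ u → ¬ Graph.Adj (deleteEdges G F) u v) → degree G v ≤ length F
  isolated-degree F v iso = subst (degree G v ≤_) (length-map other F)
    (Unique-⊆-length _≟ᶠ_ (filter⁺ (T? ∘ adj v) (allFin⁺ n)) neighbour∈)
    where
    other : Edge G → Fin n
    other e with src e ≟ᶠ v
    ... | yes _ = tgt e
    ... | no _  = src e
    hits⇒other : ∀ {w} → w ≢ v → ∀ {e} → Hits G w v e → w ≡ other e
    hits⇒other w≢v {e} h with src e ≟ᶠ v | h
    ... | yes eq | inj₁ refl = contradiction eq w≢v
    ... | yes eq | inj₂ refl = refl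
    ... | no ne  | inj₁ refl = refl
    ... | no ne  | inj₂ refl = contradiction refl ne
    neighbour∈ : ∀ {w} → w ∈ filterᵇ (adj v) (allFin n) → w ∈ map other F
    neighbour∈ {w} w∈ with Equivalence.to T-≡ (proj₂ (∈-filter⁻ (T? ∘ adj v) {xs = allFin n} w∈))
    ... | vw with Any.any? (λ e → (≡-dec _≟ᶠ_ _≟ᶠ_ (proj₁ e) (w , v)) ⊎-dec (≡-dec _≟ᶠ_ _≟ᶠ_ (proj₁ e) (v , w))) F
    ...   | no none = contradiction (trans (adj-sym w v) vw , none) (iso w)
    ...   | yes some with find some
    ...     | e , e∈ , h = subst (_∈ map other F)
      (sym (hits⇒other (λ { refl → contradiction (trans (sym vw) (adj-irrefl v)) λ () }) {e} h)) (∈-map⁺ other e∈)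

  -- `F` contains every edge between the vertex set `W` and its complement.
  Respects : List (Edge G) → (Fin n → Bool) → Set
  Respects F W = ∀ e → e ∉ F → W (src e) ≡ W (tgt e)

  edge-outside : ∀ F {u v} → Graph.Adj (deleteEdges G F) u v → ∃ λ e → Hits G u v e × e ∉ F
  edge-outside F (uv , none) = let e , h = edge-between uv in e , h , λ e∈ → none (lose e∈ h)

  respects-adj : ∀ F W → Respects F W → ∀ {u v} → Graph.Adj (deleteEdges G F) u v → W u ≡ W v
  respects-adj F W resp uv with edge-outside F uv
  ... | e , inj₁ refl , e∉ = resp e e∉
  ... | e , inj₂ refl , e∉ = sym (resp e e∉)

  ¬kept⇒∈ : ∀ S e → ¬ T (not (memᵇ (LineGraph G) e S)) → e ∈ S
  ¬kept⇒∈ S e ¬p with memᵇ (LineGraph G) e S in eq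
  ... | false = contradiction _ ¬p
  ... | true  = Any.map toWitness (any⁻ (λ x → isYes (e ≟ₑ x)) S (Equivalence.from T-≡ eq))

  kept⇒∉ : ∀ S e → T (not (memᵇ (LineGraph G) e S)) → e ∉ S
  kept⇒∉ S e p e∈ with memᵇ (LineGraph G) e S | any⁺ (λ x → isYes (e ≟ₑ x)) (Any.map fromWitness e∈)
  kept⇒∉ S e () e∈ | true | _

  ∉⇒kept : ∀ S e → e ∉ S → T (not (memᵇ (LineGraph G) e S))
  ∉⇒kept S e e∉ = decidable-stable (T? _) (e∉ ∘ ¬kept⇒∈ S e)

  -- Edge connectivity of the graph from connectivity of its line graph

  module _ {K : ℕ} (robust : ∀ F → length F < K → Connected (delete (LineGraph G) F)) where

    -- Otherwise both sides contain an edge outside F, and these lie in different components of L(G) − F.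
    small-cut-isolates : ∀ F → length F < K → ∀ W {a b} → W a ≡ true → W b ≡ false → Respects F W →
                         ∃ λ v → ∀ u → ¬ Graph.Adj (deleteEdges G F) u v
    small-cut-isolates F small W {a} {b} Wa Wb resp with side true | side false
      where
      side : ∀ β → (∃ λ e → e ∉ F × W (src e) ≡ β) ⊎ (∀ v → W v ≡ β → ∀ u → ¬ Graph.Adj (deleteEdges G F) u v)
      side β with Any.any? (λ e → ¬? (e ∈? F) ×-dec (W (src e) ≟ᵇ β)) edges
      ... | yes some = let e , _ , e∉ , eq = find some in inj₁ (e , e∉ , eq)
      ... | no none  = inj₂ λ v Wv u uv → case-edge Wv uv (edge-outside F uv)
        where
        case-edge : ∀ {u v} → W v ≡ β → Graph.Adj (deleteEdges G F) u v → ¬ ∃ λ e → Hits G u v e × e ∉ F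
        case-edge Wv uv (e , inj₁ refl , e∉) = none (lose (∈-edges e) (e∉ , trans (resp e e∉) Wv))
        case-edge Wv uv (e , inj₂ refl , e∉) = none (lose (∈-edges e) (e∉ , Wv))
    ... | inj₂ iso        | _               = a , iso a Wa
    ... | inj₁ _          | inj₂ iso        = b , iso b Wb
    ... | inj₁ (e , e∉ , We) | inj₁ (f , f∉ , Wf) = contradiction
      (trans (sym We) (trans (Walk-invariant (W ∘ src ∘ proj₁) (λ {p} {q} → same {p} {q}) (robust F small (e , ∉⇒kept F e e∉) (f , ∉⇒kept F f f∉))) Wf))
      λ ()
      where
      -- A kept edge has both ends on one side of `W`, and adjacent edges share an end; so the side
      -- is constant along walks in the line graph.
      same : ∀ {p q} → Graph.Adj (delete (LineGraph G) F) p q → W (src (proj₁ p)) ≡ W (src (proj₁ q))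
      same {p , p∉} {q , q∉} (_ , shared) with resp p (kept⇒∉ F p p∉) | resp q (kept⇒∉ F q q∉) | shared
      ... | Wp | Wq | inj₁ eq                = cong W eq
      ... | Wp | Wq | inj₂ (inj₁ eq)         = trans (cong W eq) (sym Wq)
      ... | Wp | Wq | inj₂ (inj₂ (inj₁ eq))  = trans Wp (cong W eq)
      ... | Wp | Wq | inj₂ (inj₂ (inj₂ eq))  = trans Wp (trans (cong W eq) (sym Wq))

    -- A failure of connectivity names no separated pair, so the components are computed: either two
    -- of them differ and one is a side of a cut, or walks through the representatives connect
    -- everything.
    small-edgeCut-isolates : ∀ F → length F < K → ¬ Connected (deleteEdges G F) → ∃ λ v → ∀ u → ¬ Graph.Adj (deleteEdges G F) u v
    small-edgeCut-isolates F small ¬conn = isolate (any? λ x → any? λ y → ¬? (part x ≟ᶠ part y))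
      where
      open Components src tgt edges ∈-edges

      kept? : Decidable (_∉ F)
      kept? e = ¬? (e ∈? F)

      part : Fin n → Fin n
      part = component kept?

      Adj-sym′ : ∀ {a b} → Graph.Adj (deleteEdges G F) a b → Graph.Adj (deleteEdges G F) b a
      Adj-sym′ {a} {b} = Graph.Adj-sym (deleteEdges G F) {a} {b}

      reach : ∀ x → Walk (Graph.Adj (deleteEdges G F)) (part x) x
      reach = component-least kept?
        (record { refl = here ; sym = Walk-sym Adj-sym′ ; trans = Walk-trans })
        (λ e e∉ → step (edge-adj e , λ some → let f , f∈ , h = find some in e∉ (subst (_∈ F) (hits-self e {f} h) f∈)) here)

      isolate : Dec (∃ λ x → ∃ λ y → part x ≢ part y) → ∃ λ v → ∀ u → ¬ Graph.Adj (deleteEdges G F) u v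
      isolate (yes (x , y , x≢y)) = small-cut-isolates F small (λ z → does (part z ≟ᶠ part x)) {x} {y}
        (dec-true (part x ≟ᶠ part x) refl) (dec-false (part y ≟ᶠ part x) (x≢y ∘ sym))
        (λ e e∉ → cong (λ z → does (z ≟ᶠ part x)) (component-joins kept? e e∉))
      isolate (no none) = contradiction
        (λ x y → Walk-trans (Walk-sym Adj-sym′ (reach x))
          (subst (λ z → Walk _ z y) (sym (decidable-stable (part x ≟ᶠ part y) λ ne → none (x , y , ne))) (reach y)))
        ¬conn

    -- A cut with fewer than `K` edges isolates a vertex, whose degree is then too small. In the
    -- other case every minimum edge-cut is at most as large as `F`, hence isolates a vertex as
    -- well, and `G` would be super edge-connected.
    edge-connected : Connected (toGraph G) → ¬ SuperEdgeConnected G ⊎ MinDegreeAtLeast G K →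
                     ∀ F → Unique F → ∀ W {a b} → W a ≡ true → W b ≡ false → Respects F W → K ≤ length F
    edge-connected conn hyp F unique W {a} {b} Wa Wb resp with K ≤? length F
    ... | yes K≤ = K≤
    ... | no K≰ with hyp
    ...   | inj₂ minDegree = let v , iso = small-cut-isolates F (≰⇒> K≰) W Wa Wb resp in
                             ≤-trans (minDegree v) (isolated-degree F v iso)
    ...   | inj₁ ¬super = contradiction (conn , λ F′ ((_ , ¬conn) , minimal) →
                small-edgeCut-isolates F′ (≤-<-trans (minimal F (unique , cut)) (≰⇒> K≰)) ¬conn) ¬super
      where
      cut : ¬ Connected (deleteEdges G F)
      cut c = contradiction (trans (sym Wa) (trans (Walk-invariant W (respects-adj F W resp) (c a b)) Wb)) λ ()

  -- Edges that cross a partition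

  crossing? : (P : Fin n → Fin n) → Decidable (λ e → P (src e) ≢ P (tgt e))
  crossing? P e = ¬? (P (src e) ≟ᶠ P (tgt e))

  -- At least `2 * k` edges leave the class of each fixed point of `P`, and each crossing edge
  -- leaves at most two classes.
  partition-crossing : ∀ {k} → (∀ F → Unique F → ∀ W {a b} → W a ≡ true → W b ≡ false → Respects F W → 2 * k ≤ length F) →
                       ∀ P {x y} → P x ≢ P y → k * classes P ≤ ∑ edges (λ e → ⟦ crossing? P e ⟧)
  partition-crossing {k} cut P {x} {y} x≢y = *-cancelˡ-≤ 2 (begin
    2 * (k * classes P)                                          ≡⟨ *-assoc 2 k (classes P) ⟨
    2 * k * classes P                                            ≡⟨ ∑-*ˡ (allFin n) (2 * k) _ ⟨
    ∑ (allFin n) (λ z → 2 * k * ⟦ P z ≟ᶠ z ⟧)                    ≤⟨ ∑-mono (allFin n) large ⟩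
    ∑ (allFin n) (λ z → ∑ edges (λ e → ⟦ leaves? z e ⟧))         ≡⟨ ∑-swap (allFin n) edges _ ⟩
    ∑ edges (λ e → ∑ (allFin n) (λ z → ⟦ leaves? z e ⟧))         ≤⟨ ∑-mono edges two ⟩
    ∑ edges (λ e → 2 * ⟦ crossing? P e ⟧)                        ≡⟨ ∑-*ˡ edges 2 _ ⟩
    2 * ∑ edges (λ e → ⟦ crossing? P e ⟧)                        ∎)
    where
    open ≤-Reasoning
    W : Fin n → Fin n → Bool
    W z v = does (P v ≟ᶠ z)
    leaves? : ∀ z → Decidable (λ e → W z (src e) ≢ W z (tgt e))
    leaves? z e = ¬? (W z (src e) ≟ᵇ W z (tgt e))
    large : ∀ z → 2 * k * ⟦ P z ≟ᶠ z ⟧ ≤ ∑ edges (λ e → ⟦ leaves? z e ⟧)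
    large z with P z ≟ᶠ z
    ... | no _   = ≤-trans (≤-reflexive (*-zeroʳ (2 * k))) z≤n
    ... | yes eq = ≤-trans (≤-reflexive (*-identityʳ (2 * k))) (subst (2 * k ≤_) (length-filter≡∑ (leaves? z) edges)
      (cut (filter (leaves? z) edges) (filter⁺ (leaves? z) edges-Unique) (W z) {z} {proj₁ outside}
        (dec-true (P z ≟ᶠ z) eq) (dec-false (P (proj₁ outside) ≟ᶠ z) (proj₂ outside))
        (λ e e∉ → decidable-stable (W z (src e) ≟ᵇ W z (tgt e)) λ ne → e∉ (∈-filter⁺ (leaves? z) (∈-edges e) ne))))
      where
      -- The cut needs a vertex on its other side: `P x` and `P y` differ, so one of them is not
      -- `z`.
      outside : ∃ λ w → P w ≢ z
      outside with P x ≟ᶠ z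
      ... | no ne  = x , ne
      ... | yes Px = y , λ Py → x≢y (trans Px (sym Py))
    two : ∀ e → ∑ (allFin n) (λ z → ⟦ leaves? z e ⟧) ≤ 2 * ⟦ crossing? P e ⟧
    two e with P (src e) ≟ᶠ P (tgt e)
    ... | yes eq = ≤-trans
      (∑-bound (allFin n) λ z → ≤-reflexive (⟦⟧-false (leaves? z e) λ ne → ne (cong (λ v → does (v ≟ᶠ z)) eq)))
      (≤-reflexive (*-zeroʳ (length (allFin n))))
    ... | no _ = begin
      ∑ (allFin n) (λ z → ⟦ leaves? z e ⟧)                                                   ≤⟨ ∑-mono (allFin n) (λ z → ⟦⟧-cover (leaves? z e) (P (src e) ≟ᶠ z) (P (tgt e) ≟ᶠ z) (end z)) ⟩
      ∑ (allFin n) (λ z → ⟦ P (src e) ≟ᶠ z ⟧ + ⟦ P (tgt e) ≟ᶠ z ⟧)                           ≡⟨ ∑-+ (allFin n) _ _ ⟩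
      ∑ (allFin n) (λ z → ⟦ P (src e) ≟ᶠ z ⟧) + ∑ (allFin n) (λ z → ⟦ P (tgt e) ≟ᶠ z ⟧)      ≤⟨ +-mono-≤ (∑-indicator≤1 _≟ᶠ_ (allFin⁺ n) (P (src e))) (∑-indicator≤1 _≟ᶠ_ (allFin⁺ n) (P (tgt e))) ⟩
      2                                                                                      ∎
      where
      end : ∀ z → W z (src e) ≢ W z (tgt e) → P (src e) ≡ z ⊎ P (tgt e) ≡ z
      end z ne with P (src e) ≟ᶠ z | P (tgt e) ≟ᶠ z
      ... | yes p | _     = inj₁ p
      ... | no _  | yes q = inj₂ q
      ... | no _  | no _  = contradiction refl ne

-- Application to the line graph without `S`

theorem11 : (k : ℕ) → 1 ≤ k → {n : ℕ} (G : SimpleGraph n) →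
    Connected (toGraph G) →
    KConnected (LineGraph G) (2 * k) →
    (S : List (Edge G)) → length S ≤ k → (∃ λ e → e ∉ S) →
    (¬ SuperEdgeConnected G ⊎ MinDegreeAtLeast G (2 * k)) →
    HasCISTs (delete (LineGraph G) S) k
theorem11 k@(suc _) _ {n} G conn (_ , robust) S |S|≤k (e₀ , _) hyp =
  hasCISTs linked (loopless e₀) (loopless ∘ proj₁) simple adjacent
  where
  open Edges G
  H : Graph
  H = delete (LineGraph G) S
  open Graph H using (V; _≟_; Adj)

  kept? : Edge G → Bool
  kept? e = not (memᵇ (LineGraph G) e S)

  es : List V
  es = select kept? edges

  ∈-es : ∀ e → e ∈ es
  ∈-es e = ∈-select⁺ kept? e (∈-edges (proj₁ e))

  s t : V → Fin n
  s = src ∘ proj₁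
  t = tgt ∘ proj₁

  open Packing {k} _≟_ s t es ∈-es (select-Unique kept? edges-Unique) (src e₀)
  open Components s t es ∈-es

  -- At least `k * classes P` edges of `G` cross, and the removal of `S` destroys at most `k` of
  -- them.
  ample : ∀ P {x y} → P x ≢ P y → k * classes P ≤ ∑ es (λ e → ⟦ crosses? P e ⟧) + k
  ample P x≢y = begin
    k * classes P                                                                        ≤⟨ partition-crossing (edge-connected robust conn hyp) P x≢y ⟩
    ∑ edges (λ e → ⟦ crossing? P e ⟧)                                                    ≤⟨ ∑-select kept? _ (λ e → ⟦⟧≤1 (crossing? P e)) edges ⟩
    ∑ es (λ e → ⟦ crosses? P e ⟧) + length (filter (¬? ∘ T? ∘ kept?) edges)              ≤⟨ +-monoʳ-≤ _ (≤-trans deleted |S|≤k) ⟩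
    ∑ es (λ e → ⟦ crosses? P e ⟧) + k                                                    ∎
    where
    open ≤-Reasoning
    deleted : length (filter (¬? ∘ T? ∘ kept?) edges) ≤ length S
    deleted = Unique-⊆-length (_≟ᴱ_ G) (filter⁺ (¬? ∘ T? ∘ kept?) edges-Unique)
      (λ {e} e∈ → ¬kept⇒∈ S e (proj₂ (∈-filter⁻ (¬? ∘ T? ∘ kept?) {xs = edges} e∈)))

  packing : ∃ λ χ → ∀ c → Spanning χ c
  -- The recolouring may start anywhere; here all edges have the first colour, which exists as `k`
  -- is positive.
  packing = pack ample (λ _ → Fin.zero) (<-wellFounded _)

  χ : V → Fin k
  χ = proj₁ packing

  open Trees H s t es ∈-es χ

  linked : ∀ c → Linked c
  linked c g h x y = component-≼ (Coloured? χ c) g h (proj₂ packing c x y)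

  simple : ∀ {x y a b} → x ≢ y → Inc x a → Inc y a → Inc x b → Inc y b → a ≡ b
  simple {a = a} {b} x≢y xa ya xb yb = Σ-T-≡ kept?
    (hits-unique (proj₁ a) (proj₁ b) (hits-of-ends (proj₁ a) x≢y xa ya) (hits-of-ends (proj₁ b) x≢y xb yb))

  adjacent : ∀ {x a b} → a ≢ b → Inc x a → Inc x b → Adj a b
  adjacent {x} {a} {b} a≢b xa xb = a≢b ∘ Σ-T-≡ kept? , share xa xb
    where
    share : Inc x a → Inc x b → Share G (proj₁ a) (proj₁ b)
    share (inj₁ refl) (inj₁ q) = inj₁ q
    share (inj₁ refl) (inj₂ q) = inj₂ (inj₁ q)
    share (inj₂ refl) (inj₁ q) = inj₂ (inj₂ (inj₁ q))
    share (inj₂ refl) (inj₂ q) = inj₂ (inj₂ (inj₂ q))
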